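{- Let $p$ be an odd prime and let $s,t$ be integers with $1 \le s,t \le p-1$. Define \[ f(s,t) = \begin{cases} 0 & \text{if } 2t \le p-s+1,\\ \left\lfloor \frac{(s+2t-p)^2}{4}\right\rfloor & \text{if } p-s+2 \le 2t \le p+s-2,\\ s(2t-p) & \text{if } p+s-1 \le 2t,\end{cases} \qquad g(s,t) = \begin{cases} t^2 & \text{if } 2t \le s,\\ \left\lceil \frac{s(4t-s)}{4}\right\rceil & \text{if } s+1 \le 2t \le 2p-s-1,\\ s(2t-p)+(p-t)^2 & \text{if } 2p-s \le 2t.\end{cases} \] Then the set of values taken by $r(A,B,B)$, as $A,B$ range over all subsets of $\mathbb{Z}_p$ with $|A|=s$ and $|B|=t$, is exactly the set of integers $r$ with $f(s,t) \le r \le g(s,t)$.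
   Context: $\mathbb{Z}_p$ denotes the additive group of integers modulo $p$. For subsets $A,B$ of an additive group, $r(A,B,B)$ denotes the number of additive triples, i.e. the number of triples $(a,b,a+b)$ with $a \in A$, $b \in B$ and $a+b \in B$. -}

module Defs where

open import Data.Nat using (ℕ; zero; suc; _+_; _*_; _∸_; _≤ᵇ_; _/_; _%_)
open import Data.Nat.DivMod using (_mod_)
open import Data.Bool using (if_then_else_)
open import Data.Fin using (Fin; toℕ)
open import Data.Fin.Subset using (Subset; _∈_)
open import Data.Fin.Subset.Properties using (_∈?_)
open import Data.List using (List; length; filter; cartesianProduct; allFin)
open import Data.Product using (_×_; _,_)
open import Relation.Nullary using (_×-dec_)

_+ₚ_ : ∀ {n} → Fin n → Fin n → Fin n
_+ₚ_ {suc n} a b = (toℕ a + toℕ b) mod (suc n)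

r : ∀ {n} → Subset n → Subset n → ℕ
r {n} A B = length (filter (λ { (a , b) → (a ∈? A) ×-dec ((b ∈? B) ×-dec ((a +ₚ b) ∈? B)) })
                           (cartesianProduct (allFin n) (allFin n)))

-- f(s,t) from the paper (all subtractions are non-negative in the relevant branches
-- when 1 ≤ s,t ≤ p-1)
f : ℕ → ℕ → ℕ → ℕ
f p s t =
  if 2 * t ≤ᵇ (p ∸ s) + 1 then 0
  else if 2 * t ≤ᵇ (p + s) ∸ 2 then ((s + 2 * t ∸ p) * (s + 2 * t ∸ p)) / 4
  else s * (2 * t ∸ p)

-- g(s,t) from the paper; ⌈x/4⌉ = (x+3)/4
g : ℕ → ℕ → ℕ → ℕ
g p s t =
  if 2 * t ≤ᵇ s then t * t
  else if 2 * t ≤ᵇ (2 * p ∸ s) ∸ 1 then (s * (4 * t ∸ s) + 3) / 4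
  else s * (2 * t ∸ p) + (p ∸ t) * (p ∸ t)

{-# OPTIONS --safe #-}
module Submission where

-- Upper bound: Pollard's inequality, proved by induction along Dyson's transform
-- (A, B) ↦ (A ∪ B, A ∩ B), (A ∖ B, B ∖ A), with the parameter k chosen according to the regime of g.
-- Lower bound: r(A,B,B) + r(Aᶜ,B,B) = t², and f(s,t) + g(p − s,t) = t².
-- Attainment: for the interval B = [0,t), the number M(x) of b ∈ B with x + b ∈ B changes by at
-- most 1 when x moves to x + 1. Some interval A of length s, centred at 0, has at least g(s,t)
-- triples, and the complement of such an interval of length p − s has at most f(s,t). Sliding A
-- from one to the other, one point at a time, changes the count by at most 1 per step.

open import Defs
open import Data.Bool using (Bool; true; false; _∧_; _∨_; not)
open import Data.Bool.Properties using () renaming (_≟_ to _≟ᵇ_)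
open import Data.Fin using (Fin; toℕ) renaming (zero to fzero; suc to fsuc)
open import Data.Fin.Properties using (toℕ<n; toℕ-fromℕ<; toℕ-injective)
open import Data.Fin.Subset using (Subset; ∣_∣)
open import Data.Fin.Subset.Properties using (_∈?_)
open import Data.List as List using (length; filter; cartesianProduct; allFin; []; _∷_)
open import Data.List.Properties using (map-++; map-∘; map-tabulate)
open import Data.Nat using (ℕ; zero; suc; _+_; _*_; _∸_; _≤_; _<_; _≤ᵇ_; _<ᵇ_; _≡ᵇ_; z≤n; s≤s; z<s; s<s; s<s⁻¹; s≤s⁻¹; >-nonZero⁻¹; _%_; _/_; NonZero; _≤?_)
open import Data.Nat.Coprimality using (Coprime; coprime-Bézout; prime⇒coprime)
open import Data.Nat.Divisibility using (n∣m*n)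
open import Data.Nat.DivMod using (m≡m%n+[m/n]*n; m%n<n; m<n⇒m%n≡m; [m+n]%n≡m%n; [m+kn]%n≡m%n; +-distrib-/-∣ʳ; m<n⇒m/n≡0; m*n/n≡m; _mod_)
open import Data.Nat.GCD using (module Bézout)
open import Data.Nat.ListAction using () renaming (sum to Lsum)
open import Data.Nat.ListAction.Properties using (sum-++)
open import Data.Nat.Primality using (Prime)
open import Data.Nat.Properties
open import Data.Nat.Tactic.RingSolver using (solve-∀)
open import Data.Product using (_×_; _,_; ∃; ∃-syntax; proj₁; proj₂)
open import Data.Sum using (_⊎_; inj₁; inj₂; [_,_]′)
open import Data.Vec using (lookup; tabulate; []; _∷_)
open import Data.Vec.Properties using (lookup∘tabulate)
open import Function using (_∘_)
open import Function.Bundles using (_⇔_; mk⇔)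
open import Relation.Binary.PropositionalEquality
open import Relation.Nullary using (¬_; Dec; does; yes; no; contradiction; ofʸ; ofⁿ)
open import Relation.Nullary.Decidable using (_×-dec_)
open import Algebra.Properties.Semiring.Sum +-*-semiring
  using (sum; sum-cong-≗; ∑-distrib-+; ∑-comm; *-distribˡ-sum; *-distribʳ-sum)

-- With |A| = s and |B| = |D| = t, Pollard's inequality reads T ≤ st - ks + k². It is available for
-- max(0, s + t - p) ≤ k ≤ min(s, t), so the best k is an integer of this range nearest to s/2. The
-- vertex s/2 lies inside the range, above t, or below s + t - p: these are the middle, first and
-- last regimes of `g`. The induction runs over three independent sets A, B, D, because the
-- transform changes A and B but keeps D. The obstacle is progress: B must first be translated so
-- that A ∩ B is neither empty nor all of B. This is where primality enters: a nonempty proper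
-- subset of ℤ/p is not stable under any nonzero translation. Subtracted terms are moved to the
-- other side of each inequality, which turns the algebra over ℕ into semiring identities.

∑ : ℕ → (ℕ → ℕ) → ℕ
∑ n F = sum {n} (F ∘ toℕ)

∑-cong : ∀ n {F G} → (∀ i → i < n → F i ≡ G i) → ∑ n F ≡ ∑ n G
∑-cong n F≡G = sum-cong-≗ {n} (λ i → F≡G (toℕ i) (toℕ<n i))

∑-mono : ∀ n {F G} → (∀ i → i < n → F i ≤ G i) → ∑ n F ≤ ∑ n G
∑-mono zero    F≤G = z≤n
∑-mono (suc n) F≤G = +-mono-≤ (F≤G 0 z<s) (∑-mono n (λ i i<n → F≤G (suc i) (s<s i<n)))

∑-+ : ∀ n F G → ∑ n (λ i → F i + G i) ≡ ∑ n F + ∑ n G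
∑-+ n F G = ∑-distrib-+ {n} (F ∘ toℕ) (G ∘ toℕ)

∑-*ˡ : ∀ n c F → ∑ n (λ i → c * F i) ≡ c * ∑ n F
∑-*ˡ n c F = sym (*-distribˡ-sum {n} c (F ∘ toℕ))

∑-*ʳ : ∀ n c F → ∑ n (λ i → F i * c) ≡ ∑ n F * c
∑-*ʳ n c F = sym (*-distribʳ-sum {n} c (F ∘ toℕ))

∑-swap : ∀ m n (F : ℕ → ℕ → ℕ) → ∑ m (λ i → ∑ n (F i)) ≡ ∑ n (λ j → ∑ m (λ i → F i j))
∑-swap m n F = ∑-comm {m} {n} (λ i j → F (toℕ i) (toℕ j))

∑-split : ∀ m n F → ∑ (m + n) F ≡ ∑ m F + ∑ n (λ i → F (m + i))
∑-split zero    n F = refl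
∑-split (suc m) n F = trans (cong (F 0 +_) (∑-split m n (F ∘ suc))) (sym (+-assoc (F 0) _ _))

∑-snoc : ∀ n F → ∑ (suc n) F ≡ ∑ n F + F n
∑-snoc zero    F = +-comm (F 0) 0
∑-snoc (suc n) F = trans (cong (F 0 +_) (∑-snoc n (F ∘ suc))) (sym (+-assoc (F 0) _ _))

∑-const : ∀ n c → ∑ n (λ _ → c) ≡ n * c
∑-const zero    c = refl
∑-const (suc n) c = cong (c +_) (∑-const n c)

∑-prefix : ∀ {m n} F → m ≤ n → ∑ m F ≤ ∑ n F
∑-prefix {m} F m≤n with k , refl ← m≤n⇒∃[o]m+o≡n m≤n =
  subst (∑ m F ≤_) (sym (∑-split m k F)) (m≤m+n _ _)

ι : Bool → ℕ
ι true  = 1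
ι false = 0

ι≤1 : ∀ b → ι b ≤ 1
ι≤1 true  = ≤-refl
ι≤1 false = z≤n

ι-∧ : ∀ b c → ι (b ∧ c) ≡ ι b * ι c
ι-∧ true  c = sym (*-identityˡ _)
ι-∧ false c = refl

∑ι>0⇒∃ : ∀ n A → 0 < ∑ n (ι ∘ A) → ∃[ i ] (i < n × A i ≡ true)
∑ι>0⇒∃ (suc n) A pos with A 0 in A0
... | true  = 0 , z<s , A0
... | false with i , i<n , Ai ← ∑ι>0⇒∃ n (A ∘ suc) pos = suc i , s<s i<n , Ai

∑ι>1⇒∃₂ : ∀ n A → 1 < ∑ n (ι ∘ A) →
          ∃[ i ] ∃[ d ] (i + suc d < n × A i ≡ true × A (i + suc d) ≡ true)
∑ι>1⇒∃₂ (suc n) A big with A 0 in A0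
... | true  with d , d<n , Ad ← ∑ι>0⇒∃ n (A ∘ suc) (s<s⁻¹ big) = 0 , d , s<s d<n , A0 , Ad
... | false with i , d , l , Ai , Aj ← ∑ι>1⇒∃₂ n (A ∘ suc) big = suc i , d , s<s l , Ai , Aj

∑ι<n⇒∃ : ∀ n A → ∑ n (ι ∘ A) < n → ∃[ i ] (i < n × A i ≡ false)
∑ι<n⇒∃ (suc n) A small with A 0 in A0
... | false = 0 , z<s , A0
... | true  with i , i<n , Ai ← ∑ι<n⇒∃ n (A ∘ suc) (s<s⁻¹ small) = suc i , s<s i<n , Ai

-- Periodic functions and the triple count on ℤ/p

-- Subsets of ℤ/p are p-periodic Boolean functions on ℕ, so that no reduction mod p is needed.
module Cyclic (p : ℕ) .{{_ : NonZero p}} where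

  Periodic : ∀ {X : Set} → (ℕ → X) → Set
  Periodic F = ∀ x → F (p + x) ≡ F x

  shift : ∀ {X : Set} → ℕ → (ℕ → X) → ℕ → X
  shift e F x = F (e + x)

  x∙yz≡y∙xz : ∀ x y z → x + (y + z) ≡ y + (x + z)
  x∙yz≡y∙xz = solve-∀

  shift-periodic : ∀ {X : Set} e {F : ℕ → X} → Periodic F → Periodic (shift e F)
  shift-periodic e {F} per x = trans (cong F (x∙yz≡y∙xz e p x)) (per (e + x))

  periodic-* : ∀ {X : Set} {F : ℕ → X} → Periodic F → ∀ k x → F (k * p + x) ≡ F x
  periodic-* per zero    x = refl
  periodic-* {F = F} per (suc k) x =
    trans (cong F (+-assoc p (k * p) x)) (trans (per (k * p + x)) (periodic-* per k x))

  periodic-% : ∀ {X : Set} {F : ℕ → X} → Periodic F → ∀ x → F (x % p) ≡ F x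
  periodic-% {F = F} per x = begin
    F (x % p)                  ≡⟨ periodic-* per (x / p) (x % p) ⟨
    F (x / p * p + x % p)      ≡⟨ cong F (+-comm (x / p * p) (x % p)) ⟩
    F (x % p + x / p * p)      ≡⟨ cong F (m≡m%n+[m/n]*n x p) ⟨
    F x                        ∎
    where open ≡-Reasoning

  -- Cutting [0, e + p) at e and at p gives two expressions for one sum; by periodicity the first e
  -- terms cancel.
  ∑-shift : ∀ e {F} → Periodic F → ∑ p (shift e F) ≡ ∑ p F
  ∑-shift e {F} per = +-cancelˡ-≡ (∑ e F) _ _ (begin
    ∑ e F + ∑ p (shift e F)  ≡⟨ ∑-split e p F ⟨
    ∑ (e + p) F              ≡⟨ cong (λ n → ∑ n F) (+-comm e p) ⟩
    ∑ (p + e) F              ≡⟨ ∑-split p e F ⟩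
    ∑ p F + ∑ e (shift p F)  ≡⟨ cong (∑ p F +_) (∑-cong e (λ i _ → per i)) ⟩
    ∑ p F + ∑ e F            ≡⟨ +-comm (∑ p F) _ ⟩
    ∑ e F + ∑ p F            ∎)
    where open ≡-Reasoning

  periodic-term≤∑ : ∀ {F} → Periodic F → ∀ x → F x ≤ ∑ p F
  periodic-term≤∑ {F} per x = begin
    F x                ≡⟨ cong F (+-identityʳ x) ⟨
    F (x + 0)          ≤⟨ m≤m+n _ 0 ⟩
    ∑ 1 (shift x F)    ≤⟨ ∑-prefix (shift x F) (>-nonZero⁻¹ p) ⟩
    ∑ p (shift x F)    ≡⟨ ∑-shift x per ⟩
    ∑ p F              ∎
    where open ≤-Reasoning

  N : (ℕ → ℕ) → (ℕ → ℕ) → ℕ → ℕ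
  N B D x = ∑ p (λ b → B b * D (x + b))

  -- Weights with values in ℕ, rather than Boolean sets, make the count additive in each argument,
  -- so that indicators can be split into sums.
  T : (ℕ → ℕ) → (ℕ → ℕ) → (ℕ → ℕ) → ℕ
  T A B D = ∑ p (λ a → A a * N B D a)

  T-congˡ : ∀ {A A′} B D → (∀ x → A x ≡ A′ x) → T A B D ≡ T A′ B D
  T-congˡ B D eq = ∑-cong p (λ a _ → cong (_* N B D a) (eq a))

  T-+ˡ : ∀ A A′ B D → T (λ x → A x + A′ x) B D ≡ T A B D + T A′ B D
  T-+ˡ A A′ B D = trans (∑-cong p (λ a _ → *-distribʳ-+ (N B D a) (A a) (A′ a)))
                        (∑-+ p (λ a → A a * N B D a) (λ a → A′ a * N B D a))

  T-comm : ∀ A B D → T A B D ≡ T B A D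
  T-comm A B D = begin
    ∑ p (λ a → A a * N B D a)                         ≡⟨ ∑-cong p (λ a _ → ∑-*ˡ p (A a) (λ b → B b * D (a + b))) ⟨
    ∑ p (λ a → ∑ p (λ b → A a * (B b * D (a + b))))   ≡⟨ ∑-swap p p (λ a b → A a * (B b * D (a + b))) ⟩
    ∑ p (λ b → ∑ p (λ a → A a * (B b * D (a + b))))   ≡⟨ ∑-cong p (λ b _ → ∑-cong p (λ a _ → term a b)) ⟩
    ∑ p (λ b → ∑ p (λ a → B b * (A a * D (b + a))))   ≡⟨ ∑-cong p (λ b _ → ∑-*ˡ p (B b) (λ a → A a * D (b + a))) ⟩
    ∑ p (λ b → B b * N A D b)                         ∎
    where
    open ≡-Reasoning
    left-comm : ∀ x y z → x * (y * z) ≡ y * (x * z)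
    left-comm = solve-∀
    term : ∀ a b → A a * (B b * D (a + b)) ≡ B b * (A a * D (b + a))
    term a b = trans (left-comm (A a) (B b) _) (cong (λ c → B b * (A a * D c)) (+-comm a b))

  T-congʳ : ∀ A {B B′} D → (∀ x → B x ≡ B′ x) → T A B D ≡ T A B′ D
  T-congʳ A {B} {B′} D eq = trans (T-comm A B D) (trans (T-congˡ A D eq) (T-comm B′ A D))

  T-+ʳ : ∀ A B B′ D → T A (λ x → B x + B′ x) D ≡ T A B D + T A B′ D
  T-+ʳ A B B′ D = trans (T-comm A (λ x → B x + B′ x) D)
    (trans (T-+ˡ B B′ A D) (cong₂ _+_ (T-comm B A D) (T-comm B′ A D)))

  T-shift : ∀ e A {B D} → Periodic B → Periodic D → T A (shift e B) (shift e D) ≡ T A B D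
  T-shift e A {B} {D} perB perD = ∑-cong p (λ a _ → cong (A a *_) (begin
    ∑ p (λ b → B (e + b) * D (e + (a + b)))  ≡⟨ ∑-cong p (λ b _ → cong (λ x → B (e + b) * D x) (x∙yz≡y∙xz e a b)) ⟩
    ∑ p (λ b → B (e + b) * D (a + (e + b)))  ≡⟨ ∑-shift e {λ b → B b * D (a + b)} (λ b → cong₂ _*_ (perB b) (shift-periodic a perD b)) ⟩
    N B D a                                  ∎))
    where open ≡-Reasoning

  T≤∑A*∑B : ∀ A B {D} → (∀ x → D x ≤ 1) → T A B D ≤ ∑ p A * ∑ p B
  T≤∑A*∑B A B {D} D≤1 = begin
    ∑ p (λ a → A a * N B D a)  ≤⟨ ∑-mono p (λ a _ → *-monoʳ-≤ (A a) (∑-mono p (λ b _ → *-monoʳ-≤ (B b) (D≤1 (a + b))))) ⟩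
    ∑ p (λ a → A a * ∑ p (λ b → B b * 1)) ≡⟨ ∑-*ʳ p _ A ⟩
    ∑ p A * ∑ p (λ b → B b * 1) ≡⟨ cong (∑ p A *_) (∑-cong p (λ b _ → *-identityʳ (B b))) ⟩
    ∑ p A * ∑ p B  ∎
    where open ≤-Reasoning

  T≤∑B*∑D : ∀ {A} B {D} → (∀ x → A x ≤ 1) → Periodic D → T A B D ≤ ∑ p B * ∑ p D
  T≤∑B*∑D {A} B {D} A≤1 perD = begin
    T A B D                                     ≡⟨ T-comm A B D ⟩
    ∑ p (λ b → B b * N A D b)                   ≤⟨ ∑-mono p (λ b _ → *-monoʳ-≤ (B b) (∑-mono p (λ a _ → *-monoˡ-≤ (D (b + a)) (A≤1 a)))) ⟩
    ∑ p (λ b → B b * ∑ p (λ a → 1 * D (b + a))) ≡⟨ ∑-cong p (λ b _ → cong (B b *_) (trans (∑-cong p (λ a _ → *-identityˡ (D (b + a)))) (∑-shift b perD))) ⟩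
    ∑ p (λ b → B b * ∑ p D)                     ≡⟨ ∑-*ʳ p (∑ p D) B ⟩
    ∑ p B * ∑ p D                               ∎
    where open ≤-Reasoning

  -- Dyson's transform

  card : (ℕ → Bool) → ℕ
  card A = ∑ p (ι ∘ A)

  _∪_ _∩_ _∖_ : (ℕ → Bool) → (ℕ → Bool) → ℕ → Bool
  (A ∪ B) x = A x ∨ B x
  (A ∩ B) x = A x ∧ B x
  (A ∖ B) x = A x ∧ not (B x)

  module _ (A B : ℕ → Bool) where
    private
      a = ι ∘ (A ∖ B)
      b = ι ∘ (B ∖ A)
      c = ι ∘ (A ∩ B)

    ι-left : ∀ x → ι (A x) ≡ a x + c x
    ι-left x with A x | B x
    ... | true  | true  = refl
    ... | true  | false = refl
    ... | false | true  = refl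
    ... | false | false = refl

    ι-right : ∀ x → ι (B x) ≡ b x + c x
    ι-right x with A x | B x
    ... | true  | true  = refl
    ... | true  | false = refl
    ... | false | true  = refl
    ... | false | false = refl

    ι-∪ : ∀ x → ι ((A ∪ B) x) ≡ (a x + b x) + c x
    ι-∪ x with A x | B x
    ... | true  | true  = refl
    ... | true  | false = refl
    ... | false | true  = refl
    ... | false | false = refl

    card-left : card A ≡ card (A ∖ B) + card (A ∩ B)
    card-left = trans (∑-cong p (λ x _ → ι-left x)) (∑-+ p a c)

    card-right : card B ≡ card (B ∖ A) + card (A ∩ B)
    card-right = trans (∑-cong p (λ x _ → ι-right x)) (∑-+ p b c)

    card-∪ : card (A ∪ B) ≡ (card (A ∖ B) + card (B ∖ A)) + card (A ∩ B)
    card-∪ = trans (∑-cong p (λ x _ → ι-∪ x))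
         (trans (∑-+ p (λ x → a x + b x) c) (cong (_+ card (A ∩ B)) (∑-+ p a b)))

    -- This is (a + c)(b + c) = (a + b + c)c + ab, valid because `T` is bilinear and symmetric in
    -- its first two arguments.
    T-dyson : ∀ D → T (ι ∘ A) (ι ∘ B) D ≡ T (ι ∘ (A ∪ B)) c D + T a b D
    T-dyson D = begin
      T (ι ∘ A) (ι ∘ B) D
        ≡⟨ trans (T-congˡ (ι ∘ B) D ι-left) (T-+ˡ a c (ι ∘ B) D) ⟩
      T a (ι ∘ B) D + T c (ι ∘ B) D
        ≡⟨ cong₂ _+_ (trans (T-congʳ a D ι-right) (T-+ʳ a b c D))
                     (trans (T-congʳ c D ι-right) (T-+ʳ c b c D)) ⟩
      (T a b D + T a c D) + (T c b D + T c c D)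
        ≡⟨ cong (λ z → (T a b D + T a c D) + (z + T c c D)) (T-comm c b D) ⟩
      (T a b D + T a c D) + (T b c D + T c c D)
        ≡⟨ rearrange (T a b D) (T a c D) (T b c D) (T c c D) ⟩
      ((T a c D + T b c D) + T c c D) + T a b D
        ≡⟨ cong (λ z → (z + T c c D) + T a b D) (T-+ˡ a b c D) ⟨
      (T (λ x → a x + b x) c D + T c c D) + T a b D
        ≡⟨ cong (_+ T a b D) (trans (T-congˡ c D ι-∪) (T-+ˡ (λ x → a x + b x) c c D)) ⟨
      T (ι ∘ (A ∪ B)) c D + T a b D ∎
      where
      open ≡-Reasoning
      rearrange : ∀ w x y z → (w + x) + (y + z) ≡ ((x + y) + z) + w
      rearrange = solve-∀

  -- For k at most i = |A ∩ B|: union and intersection keep the same k and the same total size, and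
  -- the two differences need only the trivial bound αβ.
  dyson-small : ∀ {x y α β i k δ} → y ≤ α * β →
    x + k * (((α + β) + i) + i) ≤ ((α + β) + i) * i + k * (k + δ) →
    (x + y) + k * ((α + i) + (β + i)) ≤ (α + i) * (β + i) + k * (k + δ)
  dyson-small {x} {y} {α} {β} {i} {k} {δ} hy hx = begin
    (x + y) + k * ((α + i) + (β + i))                ≡⟨ lhs x y α β i k ⟩
    (x + k * (((α + β) + i) + i)) + y                ≤⟨ +-mono-≤ hx hy ⟩
    (((α + β) + i) * i + k * (k + δ)) + α * β        ≡⟨ rhs α β i k δ ⟩
    (α + i) * (β + i) + k * (k + δ)                  ∎
    where
    open ≤-Reasoning
    lhs : ∀ x y α β i k → (x + y) + k * ((α + i) + (β + i)) ≡ (x + k * (((α + β) + i) + i)) + y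
    lhs = solve-∀
    rhs : ∀ α β i k δ → (((α + β) + i) * i + k * (k + δ)) + α * β ≡ (α + i) * (β + i) + k * (k + δ)
    rhs = solve-∀

  -- For k = i + j beyond the intersection the roles are exchanged: union and intersection get the
  -- trivial bound iδ, and the differences get Pollard's inequality with the remainder j.
  dyson-large : ∀ {x y α β i j δ} → x ≤ i * δ →
    y + j * (α + β) ≤ α * β + j * (j + δ) →
    (x + y) + (i + j) * ((α + i) + (β + i)) ≤ (α + i) * (β + i) + (i + j) * ((i + j) + δ)
  dyson-large {x} {y} {α} {β} {i} {j} {δ} hx hy = begin
    (x + y) + (i + j) * ((α + i) + (β + i))
      ≡⟨ lhs x y α β i j ⟩
    (x + (y + j * (α + β))) + (i * (α + β + 2 * i) + 2 * (j * i))
      ≤⟨ +-monoˡ-≤ _ (+-mono-≤ hx hy) ⟩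
    (i * δ + (α * β + j * (j + δ))) + (i * (α + β + 2 * i) + 2 * (j * i))
      ≡⟨ rhs α β i j δ ⟩
    (α + i) * (β + i) + (i + j) * ((i + j) + δ) ∎
    where
    open ≤-Reasoning
    lhs : ∀ x y α β i j → (x + y) + (i + j) * ((α + i) + (β + i)) ≡
          (x + (y + j * (α + β))) + (i * (α + β + 2 * i) + 2 * (j * i))
    lhs = solve-∀
    rhs : ∀ α β i j δ → (i * δ + (α * β + j * (j + δ))) + (i * (α + β + 2 * i) + 2 * (j * i)) ≡
          (α + i) * (β + i) + (i + j) * ((i + j) + δ)
    rhs = solve-∀

  -- Existence of a translate on which the transform makes progress

  module _ {A : ℕ → Bool} (per : Periodic A) {d : ℕ} (cop : Coprime p d)
           (closed : ∀ x → A x ≡ true → A (d + x) ≡ true) where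

    closed-* : ∀ j x → A x ≡ true → A (j * d + x) ≡ true
    closed-* zero    x Ax = Ax
    closed-* (suc j) x Ax = trans (cong A (+-assoc d (j * d) x)) (closed (j * d + x) (closed-* j x Ax))

    closed-suc : ∀ x → A x ≡ true → A (suc x) ≡ true
    closed-suc x Ax with coprime-Bézout cop
    ... | Bézout.-+ u v eq = begin
      A (suc x)           ≡⟨ periodic-* per u (suc x) ⟨
      A (u * p + suc x)   ≡⟨ cong A (+-suc (u * p) x) ⟩
      A (1 + u * p + x)   ≡⟨ cong (λ z → A (z + x)) eq ⟩
      A (v * d + x)       ≡⟨ closed-* v x Ax ⟩
      true                ∎
      where open ≡-Reasoning
    -- In this case v steps of d amount to -1 mod p; the successor of x is reached from x + p by p -
    -- 1 such descents.
    ... | Bézout.+- u v eq = down (p ∸ 1) (suc x)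
          (trans (cong A (trans (+-suc (p ∸ 1) x) (cong (_+ x) (suc-pred p)))) (trans (per x) Ax))
      where
      open ≡-Reasoning
      down₁ : ∀ y → A (suc y) ≡ true → A y ≡ true
      down₁ y Ay = begin
        A y                 ≡⟨ periodic-* per u y ⟨
        A (u * p + y)       ≡⟨ cong (λ z → A (z + y)) eq ⟨
        A (1 + v * d + y)   ≡⟨ cong A (+-suc (v * d) y) ⟨
        A (v * d + suc y)   ≡⟨ closed-* v (suc y) Ay ⟩
        true                ∎
      down : ∀ k y → A (k + y) ≡ true → A y ≡ true
      down zero    y Ay = Ay
      down (suc k) y Ay = down k y (down₁ (k + y) Ay)

    closed-+ : ∀ k x → A x ≡ true → A (k + x) ≡ true
    closed-+ zero    x Ax = Ax
    closed-+ (suc k) x Ax = closed-suc (k + x) (closed-+ k x Ax)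

    closed-full : ∀ {x y} → x < p → A x ≡ true → A y ≡ true
    closed-full {x} {y} x<p Ax = begin
      A y                   ≡⟨ per y ⟨
      A (p + y)             ≡⟨ cong (λ q → A (q + y)) (m∸n+n≡m (<⇒≤ x<p)) ⟨
      A (p ∸ x + x + y)     ≡⟨ cong A (xyz (p ∸ x) x y) ⟩
      A (p ∸ x + y + x)     ≡⟨ closed-+ (p ∸ x + y) x Ax ⟩
      true                  ∎
      where
      open ≡-Reasoning
      xyz : ∀ u v w → u + v + w ≡ u + w + v
      xyz = solve-∀

  -- If no point of A left A under the translation by d, then A would be closed under it, hence
  -- under the successor, hence everything. The search below p is decidable, so the contradiction
  -- yields a witness.
  exit : ∀ {A} → Periodic A → ∀ {d} → Coprime p d → 0 < card A → card A < p →
         ∃[ a ] (a < p × A a ≡ true × A (a + d) ≡ false)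
  exit {A} per {d} cop pos small
    with anyUpTo? (λ a → (A a ≟ᵇ true) ×-dec (A (a + d) ≟ᵇ false)) p
  ... | yes found = found
  ... | no  none
    with x , x<p , Ax ← ∑ι>0⇒∃ p A pos | y , _ , Ay ← ∑ι<n⇒∃ p A small =
    contradiction (trans (sym (closed-full per cop closed {y = y} x<p Ax)) Ay) λ ()
    where
    stay : ∀ a → a < p → A a ≡ true → A (a + d) ≡ true
    stay a a<p Aa with A (a + d) in eq
    ... | true  = refl
    ... | false = contradiction (a , a<p , Aa , eq) none
    closed : ∀ x → A x ≡ true → A (d + x) ≡ true
    closed x Ax = begin
      A (d + x)      ≡⟨ periodic-% (shift-periodic d per) x ⟨
      A (d + x % p)  ≡⟨ cong A (+-comm d (x % p)) ⟩
      A (x % p + d)  ≡⟨ stay (x % p) (m%n<n x p) (trans (periodic-% per x) Ax) ⟩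
      true           ∎
      where open ≡-Reasoning

  -- The two conditions make both new second sets smaller than B: the right one for the
  -- intersection, the left one for the part of the translate outside A.
  Dyson : (A B : ℕ → Bool) → ℕ → Set
  Dyson A B e = 0 < card (A ∩ shift e B) × card (A ∩ shift e B) < card (shift e B)

  card-shift : ∀ e {A} → Periodic A → card (shift e A) ≡ card A
  card-shift e {A} per = ∑-shift e {ι ∘ A} (cong ι ∘ per)

  nonempty : ∀ {A} → Periodic A → ∀ x → A x ≡ true → 0 < card A
  nonempty {A} per x Ax = subst (_≤ card A) (cong ι Ax) (periodic-term≤∑ {ι ∘ A} (cong ι ∘ per) x)

  ∪-periodic : ∀ {A B} → Periodic A → Periodic B → Periodic (A ∪ B)
  ∪-periodic pA pB x = cong₂ _∨_ (pA x) (pB x)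

  ∩-periodic : ∀ {A B} → Periodic A → Periodic B → Periodic (A ∩ B)
  ∩-periodic pA pB x = cong₂ _∧_ (pA x) (pB x)

  ∖-periodic : ∀ {A B} → Periodic A → Periodic B → Periodic (A ∖ B)
  ∖-periodic pA pB x = cong₂ (λ a b → a ∧ not b) (pA x) (pB x)

  -- Two elements of B differ by some d prime to p, and some a in A has a + d outside A. Translating
  -- B so that the first element falls on a puts one point of B inside A and another outside.
  dyson-exists : Prime p → ∀ {A B} → Periodic A → Periodic B →
                 0 < card A → card A < p → 1 < card B → ∃ (Dyson A B)
  dyson-exists pr {A} {B} pA pB A>0 A<p B>1
    with b , d , l , Bb , Bb′ ← ∑ι>1⇒∃₂ p B B>1
    with a , a<p , Aa , Aa′ ← exit pA (prime⇒coprime pr (≤-<-trans (m≤n+m (suc d) b) l)) A>0 A<p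
    = e , nonempty (∩-periodic pA pBₑ) a (cong₂ _∧_ Aa Bₑa) , strict
    where
    -- This is b - a mod p, so that `shift e B` has at a the value of B at b.
    e = b + (p ∸ a)
    pBₑ = shift-periodic e pB
    e+a+ : ∀ x → B (e + (a + x)) ≡ B (b + x)
    e+a+ x = begin
      B (b + (p ∸ a) + (a + x)) ≡⟨ cong B (regroup b (p ∸ a) a x) ⟩
      B (p ∸ a + a + (b + x))   ≡⟨ cong (λ q → B (q + (b + x))) (m∸n+n≡m (<⇒≤ a<p)) ⟩
      B (p + (b + x))           ≡⟨ pB (b + x) ⟩
      B (b + x)                 ∎
      where
      open ≡-Reasoning
      regroup : ∀ b q a x → b + q + (a + x) ≡ q + a + (b + x)
      regroup = solve-∀
    Bₑa : B (e + a) ≡ true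
    Bₑa = trans (cong (λ x → B (e + x)) (sym (+-identityʳ a)))
         (trans (e+a+ 0) (trans (cong B (+-identityʳ b)) Bb))
    strict : card (A ∩ shift e B) < card (shift e B)
    strict = subst (card (A ∩ shift e B) <_) (sym (card-right A (shift e B)))
      (+-monoˡ-≤ _ (nonempty (∖-periodic pBₑ pA) (a + suc d)
        (cong₂ (λ u v → u ∧ not v) (trans (e+a+ (suc d)) Bb′) Aa′)))

  -- Pollard's inequality

  -- Pollard's inequality ∑ₓ min(k, r(x)) ≥ k(|A| + |B| − k), dualised to an upper bound on the
  -- number of solutions of a + b ∈ D.
  PollardBound : (k a b d t : ℕ) → Set
  PollardBound k a b d t = t + k * (a + b) ≤ a * b + k * (k + d)

  Pollard : ℕ → (A B D : ℕ → Bool) → Set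
  Pollard k A B D = PollardBound k (card A) (card B) (card D) (T (ι ∘ A) (ι ∘ B) (ι ∘ D))

  pollard-shift : ∀ k e A {B D} → Periodic B → Periodic D →
                  Pollard k A (shift e B) (shift e D) → Pollard k A B D
  pollard-shift k e A {B} {D} pB pD h = subst₂ (PollardBound k (card A) (card B))
    (card-shift e pD) (T-shift e (ι ∘ A) (cong ι ∘ pB) (cong ι ∘ pD))
    (subst (λ b → PollardBound k (card A) b (card (shift e D)) (T (ι ∘ A) (ι ∘ shift e B) (ι ∘ shift e D)))
      (card-shift e pB) h)

  pollard-full : ∀ A B {D} → Periodic D → Pollard (card B) A B D
  pollard-full A B {D} pD = begin
    T (ι ∘ A) (ι ∘ B) (ι ∘ D) + card B * (card A + card B)
      ≤⟨ +-monoˡ-≤ _ (T≤∑B*∑D (ι ∘ B) (ι≤1 ∘ A) (cong ι ∘ pD)) ⟩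
    card B * card D + card B * (card A + card B)
      ≡⟨ regroup (card B) (card A) (card D) ⟩
    card A * card B + card B * (card B + card D) ∎
    where
    open ≤-Reasoning
    regroup : ∀ k a d → k * d + k * (a + k) ≡ a * k + k * (k + d)
    regroup = solve-∀

  -- The last condition forces A to be proper once k < |B|, as `exit` demands. It survives the
  -- transform: union and intersection have the same total size, while passing to the differences
  -- lowers the sizes by 2i and k by i.
  Admissible : ℕ → (A B : ℕ → Bool) → Set
  Admissible k A B = k ≤ card A × k ≤ card B × card A + card B ≤ p + k

  -- Comparing k with |A ∩ B| decides which of the two pairs receives the induction hypothesis. Both
  -- recursive calls come in as arguments, which leaves the recursion of `pollard` structural.
  pollard-dyson : ∀ k A B {D} → Periodic D → Admissible k A B →
    (Admissible k (A ∪ B) (A ∩ B) → Pollard k (A ∪ B) (A ∩ B) D) →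
    (∀ j → Admissible j (A ∖ B) (B ∖ A) → Pollard j (A ∖ B) (B ∖ A) D) →
    Pollard k A B D
  pollard-dyson k A B {D} pD (k≤A , k≤B , A+B≤) small large =
    subst (PollardBound k (card A) (card B) (card D)) (sym (T-dyson A B (ι ∘ D)))
      (subst₂ (λ a b → PollardBound k a b (card D) (x + y)) (sym (card-left A B)) (sym (card-right A B)) split)
    where
    I = A ∩ B
    α = card (A ∖ B)
    β = card (B ∖ A)
    i = card I
    x = T (ι ∘ (A ∪ B)) (ι ∘ I) (ι ∘ D)
    y = T (ι ∘ (A ∖ B)) (ι ∘ (B ∖ A)) (ι ∘ D)
    sizes : (α + i) + (β + i) ≤ p + k
    sizes = subst₂ (λ a b → a + b ≤ p + k) (card-left A B) (card-right A B) A+B≤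
    split : PollardBound k (α + i) (β + i) (card D) (x + y)
    split with k ≤? i
    ... | yes k≤i = dyson-small {x} {y} {α} {β} {i} {k} (T≤∑A*∑B (ι ∘ (A ∖ B)) (ι ∘ (B ∖ A)) (ι≤1 ∘ D))
      (subst (λ u → PollardBound k u i (card D) x) (card-∪ A B)
        (small (≤-trans k≤i (subst (i ≤_) (sym (card-∪ A B)) (m≤n+m i _)) , k≤i ,
          subst (λ u → u + i ≤ p + k) (sym (card-∪ A B)) (subst (_≤ p + k) (regroup α β i) sizes))))
      where
      regroup : ∀ α β i → (α + i) + (β + i) ≡ (α + β + i) + i
      regroup = solve-∀
    ... | no k≰i with j , i+j≡k ← m≤n⇒∃[o]m+o≡n (≰⇒≥ k≰i) =
      subst (λ k → PollardBound k (α + i) (β + i) (card D) (x + y)) i+j≡k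
        (dyson-large {x} {y} {α} {β} {i} {j} (T≤∑B*∑D (ι ∘ I) (ι≤1 ∘ (A ∪ B)) (cong ι ∘ pD))
        (large j
          (+-cancelˡ-≤ i j α (subst₂ _≤_ (sym i+j≡k) (trans (card-left A B) (+-comm α i)) k≤A) ,
          +-cancelˡ-≤ i j β (subst₂ _≤_ (sym i+j≡k) (trans (card-right A B) (+-comm β i)) k≤B) ,
          ≤-trans (m≤m+n (α + β) i) (+-cancelˡ-≤ i _ _ (subst₂ _≤_ (regroup α β i)
            (trans (cong (p +_) (sym i+j≡k)) (x∙yz≡y∙xz p i j)) sizes)))))
      where
      regroup : ∀ α β i → (α + i) + (β + i) ≡ i + ((α + β) + i)
      regroup = solve-∀

  -- Induction on a bound n for |B|. The extreme values k = 0 and k = |B| are the trivial bounds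
  -- |A||B| and |B||D|; strictly between them Dyson's transform applies.
  pollard : Prime p → ∀ n k A B D → Periodic A → Periodic B → Periodic D →
            card B ≤ n → Admissible k A B → Pollard k A B D
  pollard pr n zero A B D pA pB pD B≤n adm = +-monoˡ-≤ 0 (T≤∑A*∑B (ι ∘ A) (ι ∘ B) (ι≤1 ∘ D))
  pollard pr zero (suc k) A B D pA pB pD B≤n (_ , k≤B , _) = contradiction (≤-trans k≤B B≤n) λ ()
  pollard pr (suc n) (suc k) A B D pA pB pD B≤n (k≤A , k≤B , A+B≤) =
    [ (λ k<B → dyson (dyson-exists pr pA pB (<-≤-trans z<s k≤A)
         (+-cancelʳ-< (card B) (card A) p (≤-<-trans A+B≤ (+-monoʳ-< p k<B))) (≤-<-trans (s≤s z≤n) k<B)))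
    , (λ k≡B → subst (λ k → Pollard k A B D) (sym k≡B) (pollard-full A B pD))
    ]′ (m≤n⇒m<n∨m≡n k≤B)
    where
    dyson : ∃ (Dyson A B) → Pollard (suc k) A B D
    dyson (e , I>0 , I<B) =
      pollard-shift (suc k) e A pB pD
        (pollard-dyson (suc k) A Bₑ pDₑ
          (k≤A , subst (suc k ≤_) (sym (card-shift e pB)) k≤B ,
           subst (λ b → card A + b ≤ p + suc k) (sym (card-shift e pB)) A+B≤)
          (pollard pr n (suc k) (A ∪ Bₑ) (A ∩ Bₑ) Dₑ (∪-periodic pA pBₑ) (∩-periodic pA pBₑ) pDₑ
            (s≤s⁻¹ (<-≤-trans I<B Bₑ≤)))
          (λ j → pollard pr n j (A ∖ Bₑ) (Bₑ ∖ A) Dₑ (∖-periodic pA pBₑ) (∖-periodic pBₑ pA) pDₑ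
            (s≤s⁻¹ (<-≤-trans (m<m+n (card (Bₑ ∖ A)) I>0) (subst (_≤ suc n) (card-right A Bₑ) Bₑ≤)))))
      where
      Bₑ = shift e B
      Dₑ = shift e D
      pBₑ = shift-periodic e pB
      pDₑ = shift-periodic e pD
      Bₑ≤ : card Bₑ ≤ suc n
      Bₑ≤ = subst (_≤ suc n) (sym (card-shift e pB)) B≤n

-- Punctured intervals, a discrete intermediate value theorem, triangular sums

∑-below : ∀ {m n} F → n ≤ m → ∑ m (λ i → ι (i <ᵇ n) * F i) ≡ ∑ n F
∑-below {m}     {zero}  F z≤n = trans (∑-const m 0) (*-zeroʳ m)
∑-below {suc m} {suc n} F (s≤s n≤m) = cong₂ _+_ (*-identityˡ (F 0)) (∑-below (F ∘ suc) n≤m)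

∑-at : ∀ {m j} (F : ℕ → ℕ) → j < m → ∑ m (λ i → ι (i ≡ᵇ j) * F i) ≡ F j
∑-at {suc m} {zero}  F z<s = trans (cong₂ _+_ (*-identityˡ (F 0)) (trans (∑-const m 0) (*-zeroʳ m))) (+-identityʳ (F 0))
∑-at {suc m} {suc j} F (s<s j<m) = ∑-at (F ∘ suc) j<m

punctured : ℕ → ℕ → ℕ → Bool
punctured n j i = (i <ᵇ n) ∧ not (i ≡ᵇ j)

ι-punctured : ∀ n j i → j < n → ι (punctured n j i) + ι (i ≡ᵇ j) ≡ ι (i <ᵇ n)
ι-punctured (suc n) zero    zero    j<n = refl
ι-punctured (suc n) zero    (suc i) j<n with i <ᵇ n
... | true  = refl
... | false = refl
ι-punctured (suc n) (suc j) zero    j<n = refl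
ι-punctured (suc n) (suc j) (suc i) j<n = ι-punctured n j i (s<s⁻¹ j<n)

∑-punctured : ∀ {m n j} (F : ℕ → ℕ) → j < n → n ≤ m → ∑ m (λ i → ι (punctured n j i) * F i) + F j ≡ ∑ n F
∑-punctured {m} {n} {j} F j<n n≤m = begin
  ∑ m (λ i → ι (punctured n j i) * F i) + F j
    ≡⟨ cong (∑ m (λ i → ι (punctured n j i) * F i) +_) (∑-at F (<-≤-trans j<n n≤m)) ⟨
  ∑ m (λ i → ι (punctured n j i) * F i) + ∑ m (λ i → ι (i ≡ᵇ j) * F i)
    ≡⟨ ∑-+ m (λ i → ι (punctured n j i) * F i) (λ i → ι (i ≡ᵇ j) * F i) ⟨
  ∑ m (λ i → ι (punctured n j i) * F i + ι (i ≡ᵇ j) * F i)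
    ≡⟨ ∑-cong m (λ i _ → trans (sym (*-distribʳ-+ (F i) (ι (punctured n j i)) _))
                               (cong (_* F i) (ι-punctured n j i j<n))) ⟩
  ∑ m (λ i → ι (i <ᵇ n) * F i)
    ≡⟨ ∑-below F n≤m ⟩
  ∑ n F ∎
  where open ≡-Reasoning

-- Only increases are bounded: φ may drop by any amount, but it cannot jump over w on the way up.
intermediate-value : ∀ n (φ : ℕ → ℕ) {w} → (∀ i → φ (suc i) ≤ suc (φ i)) →
                     φ 0 ≤ w → w ≤ φ n → ∃[ j ] (j ≤ n × φ j ≡ w)
intermediate-value zero    φ step lo hi = 0 , z≤n , ≤-antisym lo hi
intermediate-value (suc n) φ {w} step lo hi with w ≤? φ n
... | yes w≤ with j , j≤n , eq ← intermediate-value n φ step lo w≤ = j , m≤n⇒m≤1+n j≤n , eq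
... | no  w≰ = suc n , ≤-refl , ≤-antisym (≤-trans (step n) (≰⇒> w≰)) hi

-- The binomial coefficient n over 2, that is 0 + 1 + ... + (n - 1).
tri : ℕ → ℕ
tri zero    = 0
tri (suc n) = n + tri n

tri-square : ∀ n → tri n + tri (suc n) ≡ n * n
tri-square zero    = refl
tri-square (suc n) = begin
  (n + tri n) + (suc n + (n + tri n)) ≡⟨ regroup n (tri n) ⟩
  (tri n + (n + tri n)) + (2 * n + 1) ≡⟨ cong (_+ (2 * n + 1)) (tri-square n) ⟩
  n * n + (2 * n + 1)                 ≡⟨ square n ⟩
  suc n * suc n                       ∎
  where
  open ≡-Reasoning
  regroup : ∀ n x → (n + x) + (suc n + (n + x)) ≡ (x + (n + x)) + (2 * n + 1)
  regroup = solve-∀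
  square : ∀ n → n * n + (2 * n + 1) ≡ suc n * suc n
  square = solve-∀

tri-oblong : ∀ n → tri (suc n) + tri (suc n) ≡ n * suc n
tri-oblong n = begin
  (n + tri n) + (n + tri n) ≡⟨ regroup n (tri n) ⟩
  n + (tri n + (n + tri n)) ≡⟨ cong (n +_) (tri-square n) ⟩
  n + n * n                 ≡⟨ *-suc n n ⟨
  n * suc n                 ∎
  where
  open ≡-Reasoning
  regroup : ∀ n x → (n + x) + (n + x) ≡ n + (x + (n + x))
  regroup = solve-∀

∑-≥-arith : ∀ {t} F → (∀ d → t ≤ F d + d) → ∀ n → n * t ≤ ∑ n F + tri n
∑-≥-arith F h zero = z≤n
∑-≥-arith {t} F h (suc n) = begin
  t + n * t                   ≤⟨ +-mono-≤ (h n) (∑-≥-arith F h n) ⟩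
  (F n + n) + (∑ n F + tri n) ≡⟨ regroup (F n) n (∑ n F) (tri n) ⟩
  (∑ n F + F n) + (n + tri n) ≡⟨ cong (_+ (n + tri n)) (∑-snoc n F) ⟨
  ∑ (suc n) F + tri (suc n)   ∎
  where
  open ≤-Reasoning
  regroup : ∀ f n s x → (f + n) + (s + x) ≡ (s + f) + (n + x)
  regroup = solve-∀

-- The interval B = [0, t) and its profile M

module Interval (p : ℕ) .{{_ : NonZero p}} (t : ℕ) (t≤p : t ≤ p) where
  open Cyclic p

  B : ℕ → Bool
  B x = x % p <ᵇ t

  β : ℕ → ℕ
  β = ι ∘ B

  B-periodic : Periodic B
  B-periodic x = cong (_<ᵇ t) (trans (cong (_% p) (+-comm p x)) ([m+n]%n≡m%n x p))

  β-periodic : Periodic β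
  β-periodic = cong ι ∘ B-periodic

  ∑β* : ∀ F → ∑ p (λ b → β b * F b) ≡ ∑ t F
  ∑β* F = trans (∑-cong p (λ i i<p → cong (λ x → ι (x <ᵇ t) * F i) (m<n⇒m%n≡m i<p))) (∑-below F t≤p)

  card-B : card B ≡ t
  card-B = begin
    ∑ p β               ≡⟨ ∑-cong p (λ i _ → *-identityʳ (β i)) ⟨
    ∑ p (λ b → β b * 1) ≡⟨ ∑β* (λ _ → 1) ⟩
    ∑ t (λ _ → 1)       ≡⟨ trans (∑-const t 1) (*-identityʳ t) ⟩
    t                   ∎
    where open ≡-Reasoning

  β-inside : ∀ {x} → x < t → β x ≡ 1
  β-inside {x} x<t rewrite m<n⇒m%n≡m (<-≤-trans x<t t≤p) with x <ᵇ t | <⇒<ᵇ x<t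
  ... | true | _ = refl

  -- The profile is max(0, 2t - p, t - ‖x‖), where ‖x‖ is the distance from x to 0 mod p. `M-right`,
  -- `M-left` and `M-floor` give only the estimates from below; small counts are controlled through
  -- the total t² of `M` over ℤ/p.
  M : ℕ → ℕ
  M x = ∑ t (λ b → β (x + b))

  N≡M : ∀ x → N β β x ≡ M x
  N≡M x = ∑β* (λ b → β (x + b))

  M-periodic : Periodic M
  M-periodic x = ∑-cong t (λ b _ → trans (cong β (+-assoc p x b)) (β-periodic (x + b)))

  M-step : ∀ x → M (suc x) ≤ suc (M x)
  M-step x = begin
    M (suc x)                             ≡⟨ ∑-cong t (λ b _ → cong β (+-suc x b)) ⟨
    ∑ t (λ b → β (x + suc b))             ≤⟨ m≤n+m _ (β (x + 0)) ⟩
    ∑ (suc t) (λ b → β (x + b))           ≡⟨ ∑-snoc t (λ b → β (x + b)) ⟩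
    M x + β (x + t)                       ≤⟨ +-monoʳ-≤ (M x) (ι≤1 (B (x + t))) ⟩
    M x + 1                               ≡⟨ +-comm (M x) 1 ⟩
    suc (M x)                             ∎
    where open ≤-Reasoning

  -- Inclusion and exclusion for B and its translate by -x, whose union has at most p points.
  M-floor : ∀ x → t + t ≤ M x + p
  M-floor x = begin
    t + t                                  ≡⟨ cong₂ _+_ card-B (trans (∑-shift x β-periodic) card-B) ⟨
    ∑ p β + ∑ p (shift x β)                ≡⟨ ∑-+ p β (shift x β) ⟨
    ∑ p (λ b → β b + β (x + b))            ≤⟨ ∑-mono p (λ b _ → incl-excl (B b) (B (x + b))) ⟩
    ∑ p (λ b → β b * β (x + b) + 1)        ≡⟨ ∑-+ p (λ b → β b * β (x + b)) (λ _ → 1) ⟩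
    N β β x + ∑ p (λ _ → 1)                ≡⟨ cong₂ _+_ (N≡M x) (trans (∑-const p 1) (*-identityʳ p)) ⟩
    M x + p                                ∎
    where
    open ≤-Reasoning
    incl-excl : ∀ b c → ι b + ι c ≤ ι b * ι c + 1
    incl-excl true  true  = ≤-refl
    incl-excl true  false = ≤-refl
    incl-excl false true  = ≤-refl
    incl-excl false false = z≤n

  private
    ∑β-inside : ∀ k → k ≤ t → ∑ k β ≡ k
    ∑β-inside k k≤t = trans (∑-cong k (λ b b<k → β-inside (<-≤-trans b<k k≤t)))
                            (trans (∑-const k 1) (*-identityʳ k))

    within : ∀ {d x} → (∀ k → d + k ≡ t → k ≤ x) → t ≤ x + d
    within {d} {x} h with t ≤? d
    ... | yes t≤d = ≤-trans t≤d (m≤n+m d x)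
    ... | no  t≰d with k , eq ← m≤n⇒∃[o]m+o≡n (≰⇒≥ t≰d) =
      subst (_≤ x + d) (trans (+-comm k d) eq) (+-monoˡ-≤ d (h k eq))

  M-right : ∀ d → t ≤ M d + d
  M-right d = within λ k eq → begin
    k                        ≡⟨ trans (∑-const k 1) (*-identityʳ k) ⟨
    ∑ k (λ _ → 1)            ≡⟨ ∑-cong k (λ b b<k → β-inside (<-≤-trans (+-monoʳ-< d b<k) (≤-reflexive eq))) ⟨
    ∑ k (λ b → β (d + b))    ≤⟨ ∑-prefix (λ b → β (d + b)) (m+n≤o⇒n≤o d (≤-reflexive eq)) ⟩
    M d                      ∎
    where open ≤-Reasoning

  -- Here y stands for -d: the window [y, y + t) reaches p after d steps, and its other t - d points
  -- wrap around into B.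
  M-left : ∀ {y d} → y + d ≡ p → t ≤ M y + d
  M-left {y} {d} y+d≡p = within λ k eq → begin
    k                                                  ≡⟨ ∑β-inside k (m+n≤o⇒n≤o d (≤-reflexive eq)) ⟨
    ∑ k β                                              ≡⟨ ∑-cong k (λ b _ → wrap b) ⟨
    ∑ k (λ b → β (y + (d + b)))                        ≤⟨ m≤n+m _ (∑ d (λ b → β (y + b))) ⟩
    ∑ d (λ b → β (y + b)) + ∑ k (λ b → β (y + (d + b))) ≡⟨ ∑-split d k (λ b → β (y + b)) ⟨
    ∑ (d + k) (λ b → β (y + b))                        ≡⟨ cong (λ n → ∑ n (λ b → β (y + b))) eq ⟩
    M y                                                ∎
    where
    open ≤-Reasoning
    wrap : ∀ b → β (y + (d + b)) ≡ β b
    wrap b = trans (cong β (trans (sym (+-assoc y d b)) (cong (_+ b) y+d≡p))) (β-periodic b)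

  -- For s ≤ p, the number of triples when A is the cyclic interval [y, y + s).
  S : ℕ → ℕ → ℕ
  S s y = ∑ s (λ i → M (y + i))

  S-first : ∀ s y → S (suc s) y ≡ M y + S s (suc y)
  S-first s y = cong₂ _+_ (cong M (+-identityʳ y)) (∑-cong s (λ i _ → cong M (+-suc y i)))

  S-left : ∀ m {y} → y + m ≡ p → m * t ≤ S m y + tri (suc m)
  S-left zero    eq = z≤n
  S-left (suc m) {y} eq = begin
    t + m * t
      ≤⟨ +-mono-≤ (M-left eq) (S-left m (trans (sym (+-suc y m)) eq)) ⟩
    (M y + suc m) + (S m (suc y) + tri (suc m))
      ≡⟨ regroup (M y) (suc m) (S m (suc y)) (tri (suc m)) ⟩
    (M y + S m (suc y)) + tri (suc (suc m))
      ≡⟨ cong (_+ tri (suc (suc m))) (S-first m y) ⟨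
    S (suc m) y + tri (suc (suc m)) ∎
    where
    open ≤-Reasoning
    regroup : ∀ a b c d → (a + b) + (c + d) ≡ (a + c) + (b + d)
    regroup = solve-∀

  S-split : ∀ m n y → S (m + n) y ≡ S m y + S n (y + m)
  S-split m n y = trans (∑-split m n (λ i → M (y + i)))
    (cong (S m y +_) (∑-cong n (λ i _ → cong M (sym (+-assoc y m i)))))

  S-last : ∀ s y → S (suc s) y ≡ S s y + M (y + s)
  S-last s y = ∑-snoc s (λ i → M (y + i))

  S-wrap : ∀ s y → S s (p + y) ≡ S s y
  S-wrap s y = ∑-cong s (λ i _ → trans (cong M (+-assoc p y i)) (M-periodic (y + i)))

  S-around-0 : ∀ m n {y} → y + m ≡ p → S (m + n) y ≡ S m y + ∑ n M
  S-around-0 m n {y} eq = trans (S-split m n y)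
    (cong (S m y +_) (∑-cong n (λ i _ → trans (cong (λ q → M (q + i)) eq) (M-periodic i))))

  -- The interval runs from -m to n - 1. Against the peak value t, its points lose at most their
  -- distances to 0: 1 + ... + m on the left and 0 + ... + (n - 1) on the right.
  S-near : ∀ m n → m ≤ p → (m + n) * t ≤ S (m + n) (p ∸ m) + (tri (suc m) + tri n)
  S-near m n m≤p = begin
    (m + n) * t                                             ≡⟨ *-distribʳ-+ t m n ⟩
    m * t + n * t                                           ≤⟨ +-mono-≤ (S-left m eq) (∑-≥-arith M M-right n) ⟩
    (S m (p ∸ m) + tri (suc m)) + (∑ n M + tri n)           ≡⟨ regroup (S m (p ∸ m)) (tri (suc m)) (∑ n M) (tri n) ⟩
    (S m (p ∸ m) + ∑ n M) + (tri (suc m) + tri n)           ≡⟨ cong (_+ (tri (suc m) + tri n)) (S-around-0 m n eq) ⟨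
    S (m + n) (p ∸ m) + (tri (suc m) + tri n)               ∎
    where
    open ≤-Reasoning
    eq : (p ∸ m) + m ≡ p
    eq = m∸n+n≡m m≤p
    regroup : ∀ a b c d → (a + b) + (c + d) ≡ (a + c) + (b + d)
    regroup = solve-∀

  near-balanced : ∀ m n → n ≡ m ⊎ n ≡ suc m → m ≤ p → (m + n) * t ≤ S (m + n) (p ∸ m) + m * n
  near-balanced m n n≈m m≤p = subst (λ z → (m + n) * t ≤ S (m + n) (p ∸ m) + z) (tris n≈m) (S-near m n m≤p)
    where
    tris : n ≡ m ⊎ n ≡ suc m → tri (suc m) + tri n ≡ m * n
    tris (inj₁ refl) = trans (+-comm (tri (suc m)) (tri m)) (tri-square m)
    tris (inj₂ refl) = tri-oblong m

  -- The 2u points around 0 are estimated by the slope, which descends from t to the floor c = t -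
  -- u; the e points after them are credited with c each.
  near-flat : ∀ {c u e} → c + u ≡ t → u ≤ p → (∀ x → c ≤ M x) →
              ((u + u) + e) * c + u * u ≤ S ((u + u) + e) (p ∸ u)
  near-flat {c} {u} {e} c+u≡t u≤p c≤M = +-cancelʳ-≤ (u * u) _ _ (begin
    ((u + u) + e) * c + u * u + u * u        ≡⟨ regroup u e c ⟩
    (u + u) * (c + u) + e * c                ≡⟨ cong (λ t → (u + u) * t + e * c) c+u≡t ⟩
    (u + u) * t + e * c                      ≤⟨ +-mono-≤ (near-balanced u u (inj₁ refl) u≤p) tail ⟩
    (S (u + u) y + u * u) + S e (y + (u + u)) ≡⟨ swap (S (u + u) y) (u * u) (S e (y + (u + u))) ⟩
    (S (u + u) y + S e (y + (u + u))) + u * u ≡⟨ cong (_+ u * u) (S-split (u + u) e y) ⟨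
    S ((u + u) + e) y + u * u                ∎)
    where
    open ≤-Reasoning
    y = p ∸ u
    regroup : ∀ u e c → ((u + u) + e) * c + u * u + u * u ≡ (u + u) * (c + u) + e * c
    regroup = solve-∀
    swap : ∀ a b c → (a + b) + c ≡ (a + c) + b
    swap = solve-∀
    tail : e * c ≤ S e (y + (u + u))
    tail = subst (_≤ S e (y + (u + u))) (∑-const e c) (∑-mono e (λ i _ → c≤M (y + (u + u) + i)))

  -- Sliding A through all intermediate counts

  module _ {s : ℕ} (s<p : s < p) where

    Attained : ℕ → Set
    Attained v = ∃[ A ] (Periodic A × card A ≡ s × T (ι ∘ A) β β ≡ v)

    attain-punctured : ∀ {v} y j → j ≤ s → v + M (y + j) ≡ S (suc s) y → Attained v
    attain-punctured {v} y j j≤s eq = A , A-periodic , cardA , TA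
      where
      open ≡-Reasoning
      I = punctured (suc s) j
      A : ℕ → Bool
      -- `(p ∸ 1) * y` is -y mod p, so `I` is read at x - y.
      A x = I ((x + (p ∸ 1) * y) % p)
      A-periodic : Periodic A
      A-periodic x = cong I (trans (cong (_% p) (trans (+-assoc p x _) (+-comm p _))) ([m+n]%n≡m%n _ p))
      A-shift : ∀ {i} → i < p → A (y + i) ≡ I i
      A-shift {i} i<p = cong I (begin
        (y + i + (p ∸ 1) * y) % p  ≡⟨ cong (_% p) (regroup y i ((p ∸ 1) * y)) ⟩
        (i + suc (p ∸ 1) * y) % p  ≡⟨ cong (λ q → (i + q * y) % p) (suc-pred p) ⟩
        (i + p * y) % p            ≡⟨ cong (λ q → (i + q) % p) (*-comm p y) ⟩
        (i + y * p) % p            ≡⟨ [m+kn]%n≡m%n i y p ⟩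
        i % p                      ≡⟨ m<n⇒m%n≡m i<p ⟩
        i                          ∎)
        where
        regroup : ∀ y i z → y + i + z ≡ i + (y + z)
        regroup = solve-∀
      ∑A : ∀ {F} → Periodic F → ∑ p (λ a → ι (A a) * F a) + F (y + j) ≡ ∑ (suc s) (λ i → F (y + i))
      ∑A {F} perF = begin
        ∑ p (λ a → ι (A a) * F a) + F (y + j)
          ≡⟨ cong (_+ F (y + j)) (∑-shift y {λ a → ι (A a) * F a} (λ x → cong₂ _*_ (cong ι (A-periodic x)) (perF x))) ⟨
        ∑ p (λ i → ι (A (y + i)) * F (y + i)) + F (y + j)
          ≡⟨ cong (_+ F (y + j)) (∑-cong p (λ i i<p → cong (λ b → ι b * F (y + i)) (A-shift i<p))) ⟩
        ∑ p (λ i → ι (I i) * F (y + i)) + F (y + j)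
          ≡⟨ ∑-punctured (λ i → F (y + i)) (s≤s j≤s) s<p ⟩
        ∑ (suc s) (λ i → F (y + i)) ∎
      cardA : card A ≡ s
      cardA = +-cancelʳ-≡ 1 (card A) s (begin
        card A + 1                     ≡⟨ cong (_+ 1) (∑-cong p (λ a _ → *-identityʳ (ι (A a)))) ⟨
        ∑ p (λ a → ι (A a) * 1) + 1    ≡⟨ ∑A {λ _ → 1} (λ _ → refl) ⟩
        ∑ (suc s) (λ _ → 1)            ≡⟨ trans (∑-const (suc s) 1) (*-identityʳ (suc s)) ⟩
        suc s                          ≡⟨ +-comm 1 s ⟩
        s + 1                          ∎)
      TA : T (ι ∘ A) β β ≡ v
      TA = +-cancelʳ-≡ (M (y + j)) _ v (begin
        T (ι ∘ A) β β + M (y + j)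
          ≡⟨ cong (_+ M (y + j)) (∑-cong p (λ a _ → cong (ι (A a) *_) (N≡M a))) ⟩
        ∑ p (λ a → ι (A a) * M a) + M (y + j)
          ≡⟨ ∑A M-periodic ⟩
        S (suc s) y
          ≡⟨ eq ⟨
        v + M (y + j) ∎)

    missing-≥ : ∀ {v w} y → v + w ≡ S (suc s) y → v ≤ S s (suc y) → M (y + 0) ≤ w
    missing-≥ {v} {w} y v+w≡ hi = subst (λ x → M x ≤ w) (sym (+-identityʳ y))
      (+-cancelʳ-≤ (S s (suc y)) (M y) w (begin
        M y + S s (suc y) ≡⟨ trans v+w≡ (S-first s y) ⟨
        v + w             ≤⟨ +-monoˡ-≤ w hi ⟩
        S s (suc y) + w   ≡⟨ +-comm _ w ⟩
        w + S s (suc y)   ∎))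
      where open ≤-Reasoning

    missing-≤ : ∀ {v w} y → v + w ≡ S (suc s) y → S s y ≤ v → w ≤ M (y + s)
    missing-≤ {v} {w} y v+w≡ lo = +-cancelˡ-≤ (S s y) w (M (y + s)) (begin
      S s y + w         ≤⟨ +-monoˡ-≤ w lo ⟩
      v + w             ≡⟨ trans v+w≡ (S-last s y) ⟩
      S s y + M (y + s) ∎)
      where open ≤-Reasoning

    -- Both [y, y+s) and [y+1, y+1+s) are [y, y+s] minus an end point; moving the missing
    -- point from one end to the other changes the number of triples by at most 1 per step.
    attain-adjacent : ∀ {v} y → S s y ≤ v → v ≤ S s (suc y) → Attained v
    attain-adjacent {v} y lo hi
      -- Removing y + j from [y, y + s] leaves v triples exactly when `M (y + j)` is w. The bounds
      -- on v place w between `M` at y and `M` at y + s.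
      with w , v+w≡ ← m≤n⇒∃[o]m+o≡n (≤-trans hi (subst (S s (suc y) ≤_) (sym (S-first s y)) (m≤n+m _ (M y))))
      with j , j≤s , Mj≡w ← intermediate-value s (λ i → M (y + i))
             (λ i → subst (λ x → M x ≤ suc (M (y + i))) (sym (+-suc y i)) (M-step (y + i)))
             (missing-≥ y v+w≡ hi) (missing-≤ y v+w≡ lo)
      = attain-punctured y j j≤s (trans (cong (v +_) Mj≡w) v+w≡)

    -- The interval advances while its count stays below v; the first advance that reaches v joins
    -- two adjacent intervals.
    attain-+ : ∀ {v} k y → S s y ≤ v → v ≤ S s (k + y) → Attained v
    attain-+ {v} zero    y lo hi = attain-punctured y s ≤-refl
      (trans (cong (_+ M (y + s)) (≤-antisym hi lo)) (sym (S-last s y)))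
    attain-+ {v} (suc k) y lo hi with v ≤? S s (suc y)
    ... | yes v≤ = attain-adjacent y lo v≤
    ... | no  v≰ = attain-+ k (suc y) (≰⇒≥ v≰) (subst (λ x → v ≤ S s x) (sym (+-suc k y)) hi)

    attain : ∀ {v} y z → S s y ≤ v → v ≤ S s z → Attained v
    -- That many steps lead from y to z + yp, which is z mod p, so z may also be smaller than y.
    attain {v} y z lo hi = attain-+ (z + y * (p ∸ 1)) y lo (subst (v ≤_) (sym wrap) hi)
      where
      wrap : S s (z + y * (p ∸ 1) + y) ≡ S s z
      wrap = trans (cong (S s) (trans (regroup z y (p ∸ 1)) (cong (λ q → y * q + z) (suc-pred p))))
                   (periodic-* (S-wrap s) y z)
        where
        regroup : ∀ z y q → z + y * q + y ≡ y * suc q + z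
        regroup = solve-∀

-- The regimes of g and the choice of k

-- In the rounded middle regime, m = ⌊s/2⌋ and n = ⌈s/2⌉.
data GView (p s t : ℕ) : ℕ → Set where
  balanced  : ∀ m n {v} → n ≡ m ⊎ n ≡ suc m → s ≡ m + n → s < 2 * t → s + 2 * t < 2 * p →
              v + m * n ≡ s * t → GView p s t v
  flat-low  : ∀ e → s ≡ (t + t) + e → GView p s t (t * t)
  flat-high : ∀ c u e → t ≡ c + u → p ≡ (c + u) + u → s ≡ (u + u) + e → GView p s t (s * c + u * u)

halves : ∀ s → ∃[ m ] ∃[ n ] (s ≡ m + n × (n ≡ m ⊎ n ≡ suc m))
halves zero    = 0 , 0 , refl , inj₁ refl
halves (suc s) with halves s
... | m , n , refl , inj₁ n≡m = m , suc n , sym (+-suc m n) , inj₂ (cong suc n≡m)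
... | m , n , refl , inj₂ n≡1+m = suc m , n , refl , inj₁ n≡1+m

2*n≡n+n : ∀ n → 2 * n ≡ n + n
2*n≡n+n n = cong (n +_) (+-identityʳ n)

*4/4 : ∀ {r} v → r < 4 → (r + v * 4) / 4 ≡ v
*4/4 {r} v r<4 = trans (+-distrib-/-∣ʳ r (n∣m*n v)) (cong₂ _+_ (m<n⇒m/n≡0 r<4) (m*n/n≡m v 4))

half≤ : ∀ {m n} → 2 * m ≤ 2 * n → m ≤ n
half≤ {m} {n} = *-cancelˡ-≤ 2

halves-≤ : ∀ {m n s} → n ≡ m ⊎ n ≡ suc m → s ≡ m + n → 2 * m ≤ s × s ≤ suc (2 * m) × n ≤ suc m
halves-≤ {m} (inj₁ refl) refl = ≤-reflexive (2*n≡n+n m) , ≤-trans (≤-reflexive (sym (2*n≡n+n m))) (n≤1+n _) , n≤1+n m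
halves-≤ {m} (inj₂ refl) refl = ≤-trans (≤-reflexive (2*n≡n+n m)) (+-monoʳ-≤ m (n≤1+n m)) ,
  ≤-reflexive (trans (+-suc m m) (cong suc (sym (2*n≡n+n m)))) , ≤-refl

-- ⌈s(4t − s)/4⌉ = st − ⌊s/2⌋⌈s/2⌉, and 4⌊s/2⌋⌈s/2⌉ is s² or s² − 1.
⌈s[4t∸s]/4⌉ : ∀ m n t v → n ≡ m ⊎ n ≡ suc m → v + m * n ≡ (m + n) * t →
              ((m + n) * (4 * t ∸ (m + n)) + 3) / 4 ≡ v
⌈s[4t∸s]/4⌉ m n t v n≈m eq = trans (cong (λ z → (z + 3) / 4) (numerator n≈m)) (value n≈m)
  where
  ε : n ≡ m ⊎ n ≡ suc m → ℕ
  ε (inj₁ _) = 0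
  ε (inj₂ _) = 1
  square : ∀ c → (m + n) * (m + n) ≡ 4 * (m * n) + ε c
  square (inj₁ refl) = lemma m
    where
    lemma : ∀ m → (m + m) * (m + m) ≡ 4 * (m * m) + 0
    lemma = solve-∀
  square (inj₂ refl) = lemma m
    where
    lemma : ∀ m → (m + suc m) * (m + suc m) ≡ 4 * (m * suc m) + 1
    lemma = solve-∀
  numerator : ∀ c → (m + n) * (4 * t ∸ (m + n)) ≡ 4 * v ∸ ε c
  numerator c = begin
    (m + n) * (4 * t ∸ (m + n))                   ≡⟨ *-distribˡ-∸ (m + n) (4 * t) (m + n) ⟩
    (m + n) * (4 * t) ∸ (m + n) * (m + n)         ≡⟨ cong₂ _∸_ (left-comm (m + n) t) (square c) ⟩
    4 * ((m + n) * t) ∸ (4 * (m * n) + ε c)       ≡⟨ cong (λ z → 4 * z ∸ (4 * (m * n) + ε c)) eq ⟨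
    4 * (v + m * n) ∸ (4 * (m * n) + ε c)         ≡⟨ cong (_∸ (4 * (m * n) + ε c)) (expand v (m * n)) ⟩
    (4 * (m * n) + 4 * v) ∸ (4 * (m * n) + ε c)   ≡⟨ [m+n]∸[m+o]≡n∸o (4 * (m * n)) (4 * v) (ε c) ⟩
    4 * v ∸ ε c                                   ∎
    where
    open ≡-Reasoning
    left-comm : ∀ s t → s * (4 * t) ≡ 4 * (s * t)
    left-comm = solve-∀
    expand : ∀ v x → 4 * (v + x) ≡ 4 * x + 4 * v
    expand = solve-∀
  value : ∀ c → (4 * v ∸ ε c + 3) / 4 ≡ v
  value (inj₁ _) = trans (cong (_/ 4) (trans (+-comm (4 * v) 3) (cong (3 +_) (*-comm 4 v)))) (*4/4 v ≤-refl)
  value (inj₂ _) = lemma v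
    where
    lemma : ∀ v → (4 * v ∸ 1 + 3) / 4 ≡ v
    lemma zero    = refl
    lemma (suc w) = trans (cong (_/ 4) (trans (cong (λ z → z ∸ 1 + 3) (*-suc 4 w)) (regroup w)))
                          (*4/4 {2} (suc w) (s≤s (s≤s (s≤s z≤n))))
      where
      regroup : ∀ w → (3 + 4 * w) + 3 ≡ 2 + suc w * 4
      regroup = solve-∀

≤∸1⇒< : ∀ {m n} → 0 < n → m ≤ n ∸ 1 → m < n
≤∸1⇒< {n = suc n} _ m≤n = s≤s m≤n

gView-balanced : ∀ {p t} s → s < p → s < 2 * t → 2 * t ≤ 2 * p ∸ s ∸ 1 →
                 GView p s t ((s * (4 * t ∸ s) + 3) / 4)
gView-balanced {p} {t} s s<p s<2t 2t≤ with m , n , refl , n≈m ← halves s =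
  subst (GView p (m + n) t) (sym (⌈s[4t∸s]/4⌉ m n t v n≈m v+mn≡))
    (balanced m n n≈m refl s<2t below v+mn≡)
  where
  v = (m + n) * t ∸ m * n
  m≤t : m ≤ t
  m≤t = half≤ (≤-trans (proj₁ (halves-≤ n≈m refl)) (<⇒≤ s<2t))
  v+mn≡ : v + m * n ≡ (m + n) * t
  v+mn≡ = m∸n+n≡m (≤-trans (≤-reflexive (*-comm m n)) (*-mono-≤ (m≤n+m n m) m≤t))
  s<2p : m + n < 2 * p
  s<2p = <-≤-trans s<p (m≤m+n p _)
  below : (m + n) + 2 * t < 2 * p
  below = begin-strict
    (m + n) + 2 * t            <⟨ +-monoʳ-< (m + n) (≤∸1⇒< (m<n⇒0<n∸m s<2p) 2t≤) ⟩
    (m + n) + (2 * p ∸ (m + n)) ≡⟨ m+[n∸m]≡n (<⇒≤ s<2p) ⟩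
    2 * p                      ∎
    where open ≤-Reasoning

m≤n⇒∃[o]o+m≡n : ∀ {m n} → m ≤ n → ∃[ o ] o + m ≡ n
m≤n⇒∃[o]o+m≡n m≤n = _ , m∸n+n≡m m≤n

u+u+2t≡2[t+u] : ∀ t u → u + u + 2 * t ≡ 2 * (t + u)
u+u+2t≡2[t+u] = solve-∀

-- The parameters are u = p - t, e = s - 2u and c = 2t - p. The hypothesis gives 2u ≤ s, and then 2u
-- ≤ s < p = t + u gives u < t, so that c exists.
gView-high : ∀ {p s t} → s < p → t < p → 2 * p ≤ s + 2 * t →
             GView p s t (s * (2 * t ∸ p) + (p ∸ t) * (p ∸ t))
gView-high {p} {s} {t} s<p t<p 2p≤
  with u , refl ← m≤n⇒∃[o]m+o≡n {t} {p} (<⇒≤ t<p)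
  with e , refl ← m≤n⇒∃[o]m+o≡n (+-cancelʳ-≤ (2 * t) (u + u) s (≤-trans (≤-reflexive (u+u+2t≡2[t+u] t u)) 2p≤))
  with c , refl ← m≤n⇒∃[o]o+m≡n (<⇒≤ (+-cancelʳ-< u u t (≤-<-trans (m≤m+n (u + u) e) s<p))) =
  subst (GView _ _ _) (cong₂ (λ a b → (u + u + e) * a + b * b)
      (sym (trans (cong (_∸ (c + u + u)) (shape c u)) (m+n∸n≡m c (c + u + u)))) (sym (m+n∸m≡n (c + u) u)))
    (flat-high c u e refl refl refl)
  where
  shape : ∀ c u → 2 * (c + u) ≡ c + (c + u + u)
  shape = solve-∀

gView : ∀ {p s t} → s < p → t < p → GView p s t (g p s t)
gView {p} {s} {t} s<p t<p with 2 * t ≤ᵇ s | ≤ᵇ-reflects-≤ (2 * t) s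
... | true  | ofʸ 2t≤s with e , refl ← m≤n⇒∃[o]m+o≡n 2t≤s = flat-low e (cong (_+ e) (2*n≡n+n t))
... | false | ofⁿ 2t≰s with 2 * t ≤ᵇ (2 * p ∸ s) ∸ 1 | ≤ᵇ-reflects-≤ (2 * t) ((2 * p ∸ s) ∸ 1)
...   | true  | ofʸ 2t≤ = gView-balanced s s<p (≰⇒> 2t≰s) 2t≤
...   | false | ofⁿ 2t≰ = gView-high s<p t<p (≤-trans (m≤n+m∸n (2 * p) s)
          (+-monoʳ-≤ s (≤-trans (m≤n+m∸n (2 * p ∸ s) 1) (≰⇒> 2t≰))))

-- The parameter k at which Pollard's inequality yields g.
g-optimum : ∀ {p s t v} → s < p → GView p s t v →
            ∃[ k ] ((k ≤ s × k ≤ t × s + t ≤ p + k) × v + k * s ≡ s * t + k * k)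
g-optimum {p} {s} {t} {v} s<p (balanced m n n≈m refl s<2t below v+mn≡)
  with 2m≤s , s≤2m+1 , _ ← halves-≤ n≈m refl =
  m , (m≤m+n m n , half≤ (≤-trans 2m≤s (<⇒≤ s<2t)) , half≤ fits) ,
  trans (regroup v m n) (cong (_+ m * m) v+mn≡)
  where
  open ≤-Reasoning
  fits : 2 * ((m + n) + t) ≤ 2 * (p + m)
  -- Rounding s/2 down to m costs one when s is odd; the strictness of s + 2t < 2p pays for it.
  fits = s≤s⁻¹ (begin-strict
    2 * ((m + n) + t)             ≡⟨ split (m + n) t ⟩
    (m + n) + ((m + n) + 2 * t)   <⟨ +-mono-≤-< s≤2m+1 below ⟩
    suc (2 * m) + 2 * p           ≡⟨ cong suc (join m p) ⟩
    suc (2 * (p + m))             ∎)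
    where
    split : ∀ s t → 2 * (s + t) ≡ s + (s + 2 * t)
    split = solve-∀
    join : ∀ m p → 2 * m + 2 * p ≡ 2 * (p + m)
    join = solve-∀
  regroup : ∀ v m n → v + m * (m + n) ≡ v + m * n + m * m
  regroup = solve-∀
g-optimum {p} {s} {t} s<p (flat-low e refl) =
  t , (≤-trans (m≤m+n t t) (m≤m+n (t + t) e) , ≤-refl , +-monoˡ-≤ t (<⇒≤ s<p)) , identity t s
  where
  identity : ∀ t s → t * t + t * s ≡ s * t + t * t
  identity = solve-∀
g-optimum s<p (flat-high c u e refl refl refl) =
  -- `u + e` is s + t - p, the least k allowed by the third condition.
  u + e , (≤-trans (m≤n+m (u + e) u) (≤-reflexive (sym (+-assoc u u e))) ,
           ≤-trans (≤-reflexive (+-comm u e)) (+-monoˡ-≤ u (<⇒≤ e<c)) ,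
           ≤-reflexive (sizes c u e)) , identity c u e
  where
  e<c : e < c
  e<c = +-cancelʳ-< (u + u) e c (subst₂ _<_ (+-comm (u + u) e) (+-assoc c u u) s<p)
  sizes : ∀ c u e → (u + u + e) + (c + u) ≡ (c + u + u) + (u + e)
  sizes = solve-∀
  identity : ∀ c u e → ((u + u + e) * c + u * u) + (u + e) * (u + u + e) ≡ (u + u + e) * (c + u) + (u + e) * (u + e)
  identity = solve-∀

-- The identity f(s,t) + g(p - s,t) = t²

⌊[a+b]²/4⌋ : ∀ a b → a ≡ b ⊎ a ≡ suc b → ((a + b) * (a + b)) / 4 ≡ a * b
⌊[a+b]²/4⌋ a b (inj₁ refl) = trans (cong (_/ 4) (square b)) (*4/4 {0} (b * b) z<s)
  where
  square : ∀ b → (b + b) * (b + b) ≡ 0 + b * b * 4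
  square = solve-∀
⌊[a+b]²/4⌋ a b (inj₂ refl) = trans (cong (_/ 4) (square b)) (*4/4 {1} (suc b * b) (s≤s z<s))
  where
  square : ∀ b → (suc b + b) * (suc b + b) ≡ 1 + suc b * b * 4
  square = solve-∀

half-of-1 : ∀ a b → a ≡ b ⊎ a ≡ suc b → a + b ≤ 1 → a * b ≡ 0
half-of-1 zero    b       _ _  = refl
half-of-1 (suc a) zero    _ _  = *-zeroʳ a
half-of-1 (suc a) (suc b) _ le = contradiction (≤-trans (≤-reflexive (sym (+-suc a b))) (s≤s⁻¹ le)) λ ()

odd-half : ∀ a b s → a ≡ b ⊎ a ≡ suc b → suc (a + b) ≡ s + s → a ≡ s
odd-half a b s (inj₁ refl) eq = 
  contradiction (sym (trans (cong suc (2*n≡n+n b)) (trans eq (sym (2*n≡n+n s))))) (even≢odd s b)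
odd-half a b s (inj₂ refl) eq =
  *-cancelˡ-≡ (suc b) s 2 (trans (2*n≡n+n (suc b)) (trans (cong suc (+-suc b b)) (trans eq (sym (2*n≡n+n s)))))

1+q≤2s : ∀ s s′ q → s′ + (q + s′) < 2 * (s + s′) → suc q ≤ s + s
1+q≤2s s s′ q below = +-cancelʳ-≤ (s′ + s′) _ _ (begin
  suc q + (s′ + s′)         ≡⟨ cong suc (r₁ q s′) ⟩
  suc (s′ + (q + s′))       ≤⟨ below ⟩
  2 * (s + s′)              ≡⟨ r₂ s s′ ⟩
  (s + s) + (s′ + s′)       ∎)
  where
  open ≤-Reasoning
  r₁ : ∀ q s′ → q + (s′ + s′) ≡ s′ + (q + s′)
  r₁ = solve-∀
  r₂ : ∀ s s′ → 2 * (s + s′) ≡ (s + s) + (s′ + s′)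
  r₂ = solve-∀

2s≤1+q : ∀ s s′ q → ¬ (q + s′ ≤ (s + s′) + s ∸ 2) → s + s ≤ suc q
2s≤1+q s s′ q high = +-cancelʳ-≤ s′ _ _ (s≤s⁻¹ (begin
  suc (s + s + s′)              ≡⟨ cong suc (r₁ s s′) ⟩
  suc ((s + s′) + s)            ≤⟨ s≤s (m≤n+m∸n ((s + s′) + s) 2) ⟩
  3 + ((s + s′) + s ∸ 2)        ≤⟨ +-monoʳ-≤ 2 (≰⇒> high) ⟩
  suc (suc q + s′)              ∎))
  where
  open ≤-Reasoning
  r₁ : ∀ s s′ → s + s + s′ ≡ (s + s′) + s
  r₁ = solve-∀

upper-half≤ : ∀ {m n t} → n ≡ m ⊎ n ≡ suc m → m + n < 2 * t → n ≤ t
upper-half≤ {m} {n} {t} n≈m lt = half≤ (begin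
  2 * n        ≡⟨ 2*n≡n+n n ⟩
  n + n        ≤⟨ +-monoˡ-≤ n (proj₂ (proj₂ (halves-≤ n≈m refl))) ⟩
  suc (m + n)  ≤⟨ lt ⟩
  2 * t        ∎)
  where open ≤-Reasoning

co-halves : ∀ {m n t} → n ≡ m ⊎ n ≡ suc m → m + n < 2 * t →
            ∃[ a ] ∃[ b ] (m + a ≡ t × n + b ≡ t × (a ≡ b ⊎ a ≡ suc b))
co-halves {m} {n} {t} n≈m lt with b , refl ← m≤n⇒∃[o]m+o≡n {n} {t} (upper-half≤ n≈m lt)
  with n≈m
... | inj₁ refl = b , b , refl , refl , inj₁ refl
... | inj₂ refl = suc b , b , +-suc m b , refl , inj₂ refl

-- With s′ = p - s, a + b is s + 2t - p. The middle regime of `g` at s′ exceeds that of `f` by one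
-- value of 2t at each end. At 2t = p - s + 1 the first branch of `f` agrees because a + b = 1 gives
-- ab = 0; at 2t = p + s - 1 the last one agrees because a = s and b = s - 1 = 2t - p.
f-balanced : ∀ s s′ t a b → a ≡ b ⊎ a ≡ suc b → 2 * t ≡ (a + b) + s′ → s′ + 2 * t < 2 * (s + s′) →
             f (s + s′) s t ≡ a * b
f-balanced s s′ t a b a≈b 2t≡ below
  rewrite m+n∸m≡n s s′ | 2t≡
  with (a + b) + s′ ≤ᵇ s′ + 1 | ≤ᵇ-reflects-≤ ((a + b) + s′) (s′ + 1)
... | true  | ofʸ low = sym (half-of-1 a b a≈b (+-cancelʳ-≤ s′ _ _ (≤-trans low (≤-reflexive (+-comm s′ 1)))))
... | false | ofⁿ _
  with (a + b) + s′ ≤ᵇ (s + s′) + s ∸ 2 | ≤ᵇ-reflects-≤ ((a + b) + s′) ((s + s′) + s ∸ 2)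
...   | true  | ofʸ _ = trans (cong (λ q → (q * q) / 4) q≡) (⌊[a+b]²/4⌋ a b a≈b)
  where
  regroup : ∀ s s′ q → s + (q + s′) ≡ q + (s + s′)
  regroup = solve-∀
  q≡ : s + ((a + b) + s′) ∸ (s + s′) ≡ a + b
  q≡ = trans (cong (_∸ (s + s′)) (regroup s s′ (a + b))) (m+n∸n≡m (a + b) (s + s′))
...   | false | ofⁿ high
  with refl ← odd-half a b s a≈b (≤-antisym (1+q≤2s s s′ (a + b) below) (2s≤1+q s s′ (a + b) high)) =
  cong (a *_) (trans (cong (_∸ (a + s′)) (regroup a b s′)) (m+n∸n≡m b (a + s′)))
  where
  regroup : ∀ a b s′ → (a + b) + s′ ≡ b + (a + s′)
  regroup = solve-∀

-- With a = t - m and b = t - n this is (t - m)(t - n) + (m + n)t - mn = t².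
f+g-balanced : ∀ {s t v} m n → n ≡ m ⊎ n ≡ suc m → m + n < 2 * t →
               (m + n) + 2 * t < 2 * (s + (m + n)) → v + m * n ≡ (m + n) * t →
               f (s + (m + n)) s t + v ≡ t * t
f+g-balanced {s} {t} {v} m n n≈m s′<2t below v+mn≡
  with a , b , refl , n+b≡t , a≈b ← co-halves {m} {n} {t} n≈m s′<2t = begin
  f (s + (m + n)) s (m + a) + v
    ≡⟨ cong (_+ v) (f-balanced s (m + n) (m + a) a b a≈b
         (trans (2*n≡n+n (m + a)) (trans (cong (m + a +_) (sym n+b≡t)) (r₁ m a n b))) below) ⟩
  a * b + v
    ≡⟨ +-cancelʳ-≡ (m * n) _ _ (begin
         a * b + v + m * n                             ≡⟨ +-assoc (a * b) v (m * n) ⟩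
         a * b + (v + m * n)                           ≡⟨ cong (a * b +_) v+mn≡ ⟩
         a * b + (m + n) * (m + a)                     ≡⟨ cong (a * b +_) (*-distribʳ-+ (m + a) m n) ⟩
         a * b + (m * (m + a) + n * (m + a))           ≡⟨ cong (λ t → a * b + (m * t + n * (m + a))) n+b≡t ⟨
         a * b + (m * (n + b) + n * (m + a))           ≡⟨ r₂ m a n b ⟩
         (m + a) * (n + b) + m * n                     ∎) ⟩
  (m + a) * (n + b)
    ≡⟨ cong ((m + a) *_) n+b≡t ⟩
  (m + a) * (m + a) ∎
  where
  open ≡-Reasoning
  r₁ : ∀ m a n b → (m + a) + (n + b) ≡ (a + b) + (m + n)
  r₁ = solve-∀
  r₂ : ∀ m a n b → a * b + (m * (n + b) + n * (m + a)) ≡ (m + a) * (n + b) + m * n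
  r₂ = solve-∀

c+p> : ∀ {c} p k → suc k ≤ c → p + suc k ∸ 2 < c + p
c+p> {c} p k s≤c = begin-strict
  p + suc k ∸ 2        ≡⟨ cong (_∸ 2) (+-suc p k) ⟩
  p + k ∸ 1            ≤⟨ m∸n≤m (p + k) 1 ⟩
  p + k                ≡⟨ +-comm p k ⟩
  k + p                <⟨ +-monoˡ-< p s≤c ⟩
  c + p                ∎
  where open ≤-Reasoning

f-high : ∀ {p c t} k → 0 < c → 2 * t ≡ c + p → (p ∸ suc k) + 1 ≤ p → suc k ≤ c → f p (suc k) t ≡ suc k * c
f-high {p} {c} {t} k c>0 2t≡ low s≤c
  rewrite 2t≡
  with c + p ≤ᵇ (p ∸ suc k) + 1 | ≤ᵇ-reflects-≤ (c + p) ((p ∸ suc k) + 1)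
... | true  | ofʸ bad = contradiction (≤-trans (m<n+m p c>0) (≤-trans bad low)) (<-irrefl refl)
... | false | ofⁿ _
  with c + p ≤ᵇ p + suc k ∸ 2 | ≤ᵇ-reflects-≤ (c + p) (p + suc k ∸ 2)
...   | true  | ofʸ bad = contradiction (≤-trans (c+p> p k s≤c) bad) (<-irrefl refl)
...   | false | ofⁿ _ = cong (suc k *_) (m+n∸n≡m c p)

s+e+2u≡ : ∀ k u e → (suc k + e) + (u + u) ≡ suc k + (u + u + e)
s+e+2u≡ = solve-∀

-- Write s for `suc k`. The equation for p forces c = s + e, so s ≤ 2t - p and `f` takes its last
-- branch sc. What remains is (s + e)(s + e + 2u) + u² = (s + e + u)².
f+g-high : ∀ k c u e → suc k + (u + u + e) ≡ c + u + u →
           f (suc k + (u + u + e)) (suc k) (c + u) + ((u + u + e) * c + u * u) ≡ (c + u) * (c + u)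
f+g-high k c u e p≡ with refl ← +-cancelʳ-≡ (u + u) (suc k + e) c (trans (s+e+2u≡ k u e) (trans p≡ (+-assoc c u u)))
  = begin
  f (suc k + (u + u + e)) (suc k) (suc k + e + u) + ((u + u + e) * (suc k + e) + u * u)
    ≡⟨ cong (_+ ((u + u + e) * (suc k + e) + u * u)) (f-high {t = suc k + e + u} k z<s (r₂ k u e) low (m≤m+n (suc k) e)) ⟩
  suc k * (suc k + e) + ((u + u + e) * (suc k + e) + u * u)
    ≡⟨ r₃ k u e ⟩
  (suc k + e + u) * (suc k + e + u) ∎
  where
  open ≡-Reasoning
  r₂ : ∀ k u e → 2 * (suc k + e + u) ≡ (suc k + e) + (suc k + (u + u + e))
  r₂ = solve-∀
  r₃ : ∀ k u e → suc k * (suc k + e) + ((u + u + e) * (suc k + e) + u * u) ≡ (suc k + e + u) * (suc k + e + u)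
  r₃ = solve-∀
  low : (suc k + (u + u + e) ∸ suc k) + 1 ≤ suc k + (u + u + e)
  low = ≤-trans (≤-reflexive (trans (cong (_+ 1) (m+n∸m≡n (suc k) (u + u + e))) (+-comm _ 1))) (s≤s (m≤n+m (u + u + e) k))

f+g≡t² : ∀ {s s′ t v} → 0 < s → GView (s + s′) s′ t v → f (s + s′) s t + v ≡ t * t
f+g≡t² {s} {s′} {t} s>0 (flat-low e refl)
  rewrite m+n∸m≡n s (t + t + e)
  with 2 * t ≤ᵇ (t + t + e) + 1 | ≤⇒≤ᵇ (≤-trans (≤-reflexive (2*n≡n+n t)) (≤-trans (m≤m+n (t + t) e) (m≤m+n (t + t + e) 1)))
... | true | _ = refl
f+g≡t² {s} s>0 (balanced m n n≈m refl s′<2t below v+mn≡) = f+g-balanced {s} m n n≈m s′<2t below v+mn≡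
f+g≡t² {suc k} s>0 (flat-high c u e refl p≡ refl) = f+g-high k c u e p≡

-- Both bounds, and attainment of every value between them

module Extremes (p : ℕ) .{{_ : NonZero p}} where
  open Cyclic p

  T-cong : ∀ {A A′ B B′ D D′} → (∀ x → A x ≡ A′ x) → (∀ x → B x ≡ B′ x) → (∀ x → D x ≡ D′ x) →
           T A B D ≡ T A′ B′ D′
  T-cong A≡ B≡ D≡ = ∑-cong p (λ a _ → cong₂ _*_ (A≡ a) (∑-cong p (λ b _ → cong₂ _*_ (B≡ b) (D≡ (a + b)))))

  ι-not : ∀ b → ι b + ι (not b) ≡ 1
  ι-not true  = refl
  ι-not false = refl

  card-complement : ∀ A → card A + card (not ∘ A) ≡ p
  card-complement A = begin
    card A + card (not ∘ A)                 ≡⟨ ∑-+ p (ι ∘ A) (ι ∘ not ∘ A) ⟨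
    ∑ p (λ x → ι (A x) + ι (not (A x)))     ≡⟨ ∑-cong p (λ x _ → ι-not (A x)) ⟩
    ∑ p (λ _ → 1)                           ≡⟨ trans (∑-const p 1) (*-identityʳ p) ⟩
    p                                       ∎
    where open ≡-Reasoning

  ∑N : ∀ B {D} → Periodic D → ∑ p (N B D) ≡ ∑ p B * ∑ p D
  ∑N B {D} perD = begin
    ∑ p (λ a → ∑ p (λ b → B b * D (a + b)))  ≡⟨ ∑-swap p p (λ a b → B b * D (a + b)) ⟩
    ∑ p (λ b → ∑ p (λ a → B b * D (a + b)))  ≡⟨ ∑-cong p (λ b _ → ∑-*ˡ p (B b) (λ a → D (a + b))) ⟩
    ∑ p (λ b → B b * ∑ p (λ a → D (a + b)))  ≡⟨ ∑-cong p (λ b _ → cong (B b *_) (trans (∑-cong p (λ a _ → cong D (+-comm a b))) (∑-shift b perD))) ⟩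
    ∑ p (λ b → B b * ∑ p D)                  ≡⟨ ∑-*ʳ p (∑ p D) B ⟩
    ∑ p B * ∑ p D                            ∎
    where open ≡-Reasoning

  T-complement : ∀ A B {D} → Periodic D →
                 T (ι ∘ A) B D + T (ι ∘ not ∘ A) B D ≡ ∑ p B * ∑ p D
  T-complement A B {D} perD = begin
    T (ι ∘ A) B D + T (ι ∘ not ∘ A) B D                ≡⟨ T-+ˡ (ι ∘ A) (ι ∘ not ∘ A) B D ⟨
    T (λ x → ι (A x) + ι (not (A x))) B D              ≡⟨ ∑-cong p (λ a _ → trans (cong (_* N B D a) (ι-not (A a))) (*-identityˡ (N B D a))) ⟩
    ∑ p (N B D)                                        ≡⟨ ∑N B perD ⟩
    ∑ p B * ∑ p D                                      ∎
    where open ≡-Reasoning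

  T≤g : Prime p → ∀ {A B} → Periodic A → Periodic B → card A < p → card B < p →
        T (ι ∘ A) (ι ∘ B) (ι ∘ B) ≤ g p (card A) (card B)
  T≤g pr {A} {B} pA pB A<p B<p with k , adm , v+ks≡ ← g-optimum A<p (gView A<p B<p) =
    +-cancelʳ-≤ (k * s + k * t) _ _ (begin
      T (ι ∘ A) (ι ∘ B) (ι ∘ B) + (k * s + k * t) ≡⟨ cong (T (ι ∘ A) (ι ∘ B) (ι ∘ B) +_) (*-distribˡ-+ k s t) ⟨
      T (ι ∘ A) (ι ∘ B) (ι ∘ B) + k * (s + t)     ≤⟨ pollard pr t k A B B pA pB pB ≤-refl adm ⟩
      s * t + k * (k + t)                         ≡⟨ trans (cong (s * t +_) (*-distribˡ-+ k k t)) (sym (+-assoc (s * t) (k * k) (k * t))) ⟩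
      s * t + k * k + k * t                       ≡⟨ cong (_+ k * t) v+ks≡ ⟨
      g p s t + k * s + k * t                     ≡⟨ +-assoc (g p s t) (k * s) (k * t) ⟩
      g p s t + (k * s + k * t)                   ∎)
    where
    open ≤-Reasoning
    s = card A
    t = card B

  f+g : ∀ {s s′ t} → s + s′ ≡ p → 0 < s → t < p → f p s t + g p s′ t ≡ t * t
  f+g {s} {s′} {t} refl s>0 t<p = f+g≡t² s>0 (gView (m<n+m s′ s>0) t<p)

  f≤T : Prime p → ∀ {A B} → Periodic A → Periodic B → 0 < card A → card B < p →
        f p (card A) (card B) ≤ T (ι ∘ A) (ι ∘ B) (ι ∘ B)
  f≤T pr {A} {B} pA pB A>0 B<p = +-cancelʳ-≤ (g p s′ t) _ _ (begin
    f p (card A) t + g p s′ t                                ≡⟨ f+g (card-complement A) A>0 B<p ⟩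
    t * t                                                    ≡⟨ T-complement A (ι ∘ B) (cong ι ∘ pB) ⟨
    T (ι ∘ A) (ι ∘ B) (ι ∘ B) + T (ι ∘ not ∘ A) (ι ∘ B) (ι ∘ B) ≤⟨ +-monoʳ-≤ _ (T≤g pr (cong not ∘ pA) pB s′<p B<p) ⟩
    T (ι ∘ A) (ι ∘ B) (ι ∘ B) + g p s′ t                     ∎)
    where
    open ≤-Reasoning
    s′ = card (not ∘ A)
    t = card B
    s′<p : s′ < p
    s′<p = subst (s′ <_) (card-complement A) (m<n+m s′ A>0)

  module _ {t : ℕ} (t<p : t < p) where
    open Interval p t (<⇒≤ t<p)

    near-GView : ∀ {s v} → s < p → GView p s t v → ∃[ y ] v ≤ S s y
    near-GView {v = v} s<p (balanced m n n≈m refl _ _ v+mn≡) = p ∸ m , +-cancelʳ-≤ (m * n) _ _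
      (subst (_≤ S (m + n) (p ∸ m) + m * n) (sym v+mn≡)
        (near-balanced m n n≈m (<⇒≤ (≤-<-trans (m≤m+n m n) s<p))))
    -- Here the floor is 0 and the slope has its full width u = t; in the last regime the floor is
    -- 2t - p.
    near-GView s<p (flat-low e refl) = p ∸ t ,
      subst (λ z → z + t * t ≤ S (t + t + e) (p ∸ t)) (*-zeroʳ (t + t + e))
        (near-flat {0} {t} {e} refl (<⇒≤ t<p) (λ _ → z≤n))
    near-GView s<p (flat-high c u e t≡ p≡ refl) = p ∸ u ,
      near-flat {c} {u} {e} (sym t≡) (≤-trans (m≤n+m u (c + u)) (≤-reflexive (sym p≡))) (λ x →
        +-cancelʳ-≤ p c (M x) (≤-trans (≤-reflexive (trans (cong (c +_) p≡)
          (trans (regroup c u) (cong₂ _+_ (sym t≡) (sym t≡))))) (M-floor x)))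
      where
      regroup : ∀ c u → c + (c + u + u) ≡ (c + u) + (c + u)
      regroup = solve-∀

    near : ∀ {s} → s < p → ∃[ y ] g p s t ≤ S s y
    near s<p = near-GView s<p (gView s<p t<p)

    S-full : ∀ y → S p y ≡ t * t
    S-full y = begin
      ∑ p (λ i → M (y + i))     ≡⟨ ∑-shift y M-periodic ⟩
      ∑ p M                     ≡⟨ ∑-cong p (λ x _ → N≡M x) ⟨
      ∑ p (N β β)               ≡⟨ ∑N β β-periodic ⟩
      card B * card B           ≡⟨ cong₂ _*_ card-B card-B ⟩
      t * t                     ∎
      where open ≡-Reasoning

    far : ∀ {s} → 0 < s → s < p → ∃[ y ] S s y ≤ f p s t
    far {s} s>0 s<p
      with s′ , s+s′≡p ← m≤n⇒∃[o]m+o≡n (<⇒≤ s<p)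
      with y , g≤S ← near {s′} (subst (s′ <_) s+s′≡p (m<n+m s′ s>0)) =
      y + s′ , +-cancelʳ-≤ (g p s′ t) _ _ (begin
        S s (y + s′) + g p s′ t     ≤⟨ +-monoʳ-≤ _ g≤S ⟩
        S s (y + s′) + S s′ y       ≡⟨ +-comm _ (S s′ y) ⟩
        S s′ y + S s (y + s′)       ≡⟨ S-split s′ s y ⟨
        S (s′ + s) y                ≡⟨ cong (λ n → S n y) (trans (+-comm s′ s) s+s′≡p) ⟩
        S p y                       ≡⟨ S-full y ⟩
        t * t                       ≡⟨ f+g s+s′≡p s>0 t<p ⟨
        f p s t + g p s′ t          ∎)
      where open ≤-Reasoning

    attain-all : ∀ {s v} → 0 < s → (s<p : s < p) → f p s t ≤ v → v ≤ g p s t → Attained s<p v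
    attain-all s>0 s<p f≤v v≤g with y , S≤f ← far s>0 s<p | z , g≤S ← near s<p =
      attain s<p y z (≤-trans S≤f f≤v) (≤-trans v≤g g≤S)

-- Translation to `Subset` and `r`

length-filter≡sum : ∀ {a ℓ} {X : Set a} {P : X → Set ℓ} (P? : ∀ x → Dec (P x)) xs →
                    length (filter P? xs) ≡ Lsum (List.map (ι ∘ does ∘ P?) xs)
length-filter≡sum P? []       = refl
length-filter≡sum P? (x ∷ xs) with does (P? x)
... | true  = cong suc (length-filter≡sum P? xs)
... | false = length-filter≡sum P? xs

sum-cartesianProduct : ∀ {a b} {X : Set a} {Y : Set b} (w : X × Y → ℕ) xs ys →
  Lsum (List.map w (cartesianProduct xs ys)) ≡ Lsum (List.map (λ x → Lsum (List.map (λ y → w (x , y)) ys)) xs)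
sum-cartesianProduct w []       ys = refl
sum-cartesianProduct w (x ∷ xs) ys = begin
  Lsum (List.map w (List.map (x ,_) ys List.++ cartesianProduct xs ys))
    ≡⟨ cong Lsum (map-++ w (List.map (x ,_) ys) (cartesianProduct xs ys)) ⟩
  Lsum (List.map w (List.map (x ,_) ys) List.++ List.map w (cartesianProduct xs ys))
    ≡⟨ sum-++ (List.map w (List.map (x ,_) ys)) _ ⟩
  Lsum (List.map w (List.map (x ,_) ys)) + Lsum (List.map w (cartesianProduct xs ys))
    ≡⟨ cong₂ _+_ (cong Lsum (sym (map-∘ ys))) (sum-cartesianProduct w xs ys) ⟩
  Lsum (List.map (λ y → w (x , y)) ys) + Lsum (List.map (λ x → Lsum (List.map (λ y → w (x , y)) ys)) xs) ∎
  where open ≡-Reasoning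

sum-tabulate : ∀ {n} (w : Fin n → ℕ) → Lsum (List.tabulate w) ≡ sum w
sum-tabulate {zero}  w = refl
sum-tabulate {suc n} w = cong (w fzero +_) (sum-tabulate (w ∘ fsuc))

sum-allFin : ∀ {n} (w : Fin n → ℕ) → Lsum (List.map w (allFin n)) ≡ sum w
sum-allFin w = trans (cong Lsum (map-tabulate (λ i → i) w)) (sum-tabulate w)

does-∈? : ∀ {n} (i : Fin n) (A : Subset n) → does (i ∈? A) ≡ lookup A i
does-∈? fzero    (true ∷ A)  = refl
does-∈? fzero    (false ∷ A) = refl
does-∈? (fsuc i) (_ ∷ A)     = does-∈? i A

∣∣≡sum : ∀ {n} (A : Subset n) → ∣ A ∣ ≡ sum (λ i → ι (lookup A i))
∣∣≡sum []          = refl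
∣∣≡sum (true ∷ A)  = cong suc (∣∣≡sum A)
∣∣≡sum (false ∷ A) = ∣∣≡sum A

module Translate (q : ℕ) where
  p = suc q
  open Cyclic p
  open Extremes p

  χ : Subset p → ℕ → Bool
  χ A x = lookup A (x mod p)

  toℕ-mod : ∀ x → toℕ (x mod p) ≡ x % p
  toℕ-mod x = toℕ-fromℕ< (m%n<n x p)

  χ-periodic : ∀ A → Periodic (χ A)
  χ-periodic A x = cong (lookup A) (toℕ-injective (begin
    toℕ ((p + x) mod p) ≡⟨ toℕ-mod (p + x) ⟩
    (p + x) % p         ≡⟨ cong (_% p) (+-comm p x) ⟩
    (x + p) % p         ≡⟨ [m+n]%n≡m%n x p ⟩
    x % p               ≡⟨ toℕ-mod x ⟨
    toℕ (x mod p)       ∎))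
    where open ≡-Reasoning

  χ-toℕ : ∀ A i → χ A (toℕ i) ≡ lookup A i
  χ-toℕ A i = cong (lookup A) (toℕ-injective (trans (toℕ-mod (toℕ i)) (m<n⇒m%n≡m (toℕ<n i))))

  ∣∣≡card : ∀ A → ∣ A ∣ ≡ card (χ A)
  ∣∣≡card A = trans (∣∣≡sum A) (sum-cong-≗ {p} (λ i → cong ι (sym (χ-toℕ A i))))

  r≡T : ∀ A B → r A B ≡ T (ι ∘ χ A) (ι ∘ χ B) (ι ∘ χ B)
  r≡T A B = begin
    r A B
      -- `does` of a `_×-dec_` computes to a conjunction, so the weight of each pair is `w` by
      -- definition.
      ≡⟨ length-filter≡sum _ (cartesianProduct (allFin p) (allFin p)) ⟩
    Lsum (List.map (λ (a , b) → w a b) (cartesianProduct (allFin p) (allFin p)))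
      ≡⟨ sum-cartesianProduct (λ (a , b) → w a b) (allFin p) (allFin p) ⟩
    Lsum (List.map (λ a → Lsum (List.map (w a) (allFin p))) (allFin p))
      ≡⟨ trans (sum-allFin (λ a → Lsum (List.map (w a) (allFin p)))) (sum-cong-≗ {p} (λ a → sum-allFin (w a))) ⟩
    sum (λ a → sum (w a))
      ≡⟨ sum-cong-≗ {p} (λ a → trans (sum-cong-≗ {p} (term a))
           (sym (*-distribˡ-sum {p} (ι (χ A (toℕ a))) (λ b → ι (χ B (toℕ b)) * ι (χ B (toℕ a + toℕ b)))))) ⟩
    T (ι ∘ χ A) (ι ∘ χ B) (ι ∘ χ B) ∎
    where
    open ≡-Reasoning
    w : Fin p → Fin p → ℕ
    w a b = ι (does (a ∈? A) ∧ (does (b ∈? B) ∧ does ((a +ₚ b) ∈? B)))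
    term : ∀ a b → w a b ≡ ι (χ A (toℕ a)) * (ι (χ B (toℕ b)) * ι (χ B (toℕ a + toℕ b)))
    term a b = begin
      w a b
        ≡⟨ trans (ι-∧ (does (a ∈? A)) _) (cong (ι (does (a ∈? A)) *_) (ι-∧ (does (b ∈? B)) _)) ⟩
      ι (does (a ∈? A)) * (ι (does (b ∈? B)) * ι (does ((a +ₚ b) ∈? B)))
        -- `a +ₚ b` unfolds to `(toℕ a + toℕ b) mod p`, so the lookup there is already
        -- `χ B (toℕ a + toℕ b)`.
        ≡⟨ cong₂ _*_ (cong ι (trans (does-∈? a A) (sym (χ-toℕ A a))))
            (cong₂ _*_ (cong ι (trans (does-∈? b B) (sym (χ-toℕ B b)))) (cong ι (does-∈? (a +ₚ b) B))) ⟩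
      ι (χ A (toℕ a)) * (ι (χ B (toℕ b)) * ι (χ B (toℕ a + toℕ b))) ∎

  subset : (ℕ → Bool) → Subset p
  subset A = tabulate (A ∘ toℕ)

  χ-subset : ∀ {A} → Periodic A → ∀ x → χ (subset A) x ≡ A x
  χ-subset {A} per x = begin
    lookup (tabulate (A ∘ toℕ)) (x mod p) ≡⟨ lookup∘tabulate (A ∘ toℕ) (x mod p) ⟩
    A (toℕ (x mod p))                     ≡⟨ cong A (toℕ-mod x) ⟩
    A (x % p)                             ≡⟨ periodic-% per x ⟩
    A x                                   ∎
    where open ≡-Reasoning

  ∣subset∣ : ∀ {A} → Periodic A → ∣ subset A ∣ ≡ card A
  ∣subset∣ {A} per = trans (∣∣≡card (subset A)) (∑-cong p (λ x _ → cong ι (χ-subset per x)))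

  r-subset : ∀ {A B} → Periodic A → Periodic B → r (subset A) (subset B) ≡ T (ι ∘ A) (ι ∘ B) (ι ∘ B)
  r-subset {A} {B} pA pB = trans (r≡T (subset A) (subset B))
    (T-cong (cong ι ∘ χ-subset pA) (cong ι ∘ χ-subset pB) (cong ι ∘ χ-subset pB))

  r-bounds : Prime p → ∀ (A B : Subset p) {s t n} → ∣ A ∣ ≡ s → ∣ B ∣ ≡ t → r A B ≡ n →
             0 < s → s < p → t < p → f p s t ≤ n × n ≤ g p s t
  r-bounds pr A B refl refl refl s>0 s<p t<p rewrite r≡T A B | ∣∣≡card A | ∣∣≡card B =
    f≤T pr (χ-periodic A) (χ-periodic B) s>0 t<p , T≤g pr (χ-periodic A) (χ-periodic B) s<p t<p

mainTheorem1 : (p : ℕ) → Prime p → p % 2 ≡ 1 →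
    (s t : ℕ) → 1 ≤ s → s ≤ p ∸ 1 → 1 ≤ t → t ≤ p ∸ 1 →
    (n : ℕ) →
    (∃[ A ] ∃[ B ] (∣ A ∣ ≡ s × ∣ B ∣ ≡ t × r {p} A B ≡ n))
    ⇔ (f p s t ≤ n × n ≤ g p s t)
mainTheorem1 zero    pr _ s t s>0 s≤ t>0 t≤ n = contradiction (≤-trans s>0 s≤) λ ()
mainTheorem1 (suc q) pr _ s t s>0 s≤ t>0 t≤ n = mk⇔ bounds attained
  where
  open Cyclic (suc q)
  open Extremes (suc q)
  open Translate q hiding (p)
  s<p : s < suc q
  s<p = s≤s s≤
  t<p : t < suc q
  t<p = s≤s t≤
  bounds : ∃[ A ] ∃[ B ] (∣ A ∣ ≡ s × ∣ B ∣ ≡ t × r {suc q} A B ≡ n) → f (suc q) s t ≤ n × n ≤ g (suc q) s t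
  bounds (A , B , ∣A∣≡s , ∣B∣≡t , r≡n) = r-bounds pr A B ∣A∣≡s ∣B∣≡t r≡n s>0 s<p t<p
  attained : f (suc q) s t ≤ n × n ≤ g (suc q) s t → ∃[ A ] ∃[ B ] (∣ A ∣ ≡ s × ∣ B ∣ ≡ t × r {suc q} A B ≡ n)
  attained (f≤n , n≤g) with A , pA , cardA , TA ← attain-all t<p s>0 s<p f≤n n≤g =
    subset A , subset B , trans (∣subset∣ pA) cardA , trans (∣subset∣ B-periodic) card-B ,
    trans (r-subset pA B-periodic) TA
    where open Interval (suc q) t (<⇒≤ t<p)
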